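{- Let $d\ge 2$ be an integer. There exist $n_0(d)$ and a constant $C_d>0$ such that for all $n\ge n_0(d)$ the following holds. Let $\mathcal{F}\subseteq\binom{[n]}{d+1}$ be such that for every $F\in\mathcal{F}$ there exists a subset $B_F\subseteq F$ with $|B_F|=1$ such that $F\cap F'\neq B_F$ for all $F'\in\mathcal{F}$. Then either $\mathcal{F}$ is a star (all members contain a common element) and $|\mathcal{F}|\le\binom{n-1}{d}$, or $|\mathcal{F}|\le\binom{n-1}{d}-C_d n^{d-1}$. In particular, $|\mathcal{F}|\le \binom{n-1}{d}$.
   Context: $\binom{[n]}{k}$ denotes the family of all $k$-element subsets of $[n]=\{1,\dots,n\}$. -}

module Defs where

open import Data.Fin.Subset using (Subset; ∣_∣; _⊆_; _∩_) renaming (_∈_ to _∈ₛ_)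
open import Data.Integer using (+_)
open import Data.List using (List; length)
open import Data.List.Membership.Propositional using (_∈_)
open import Data.List.Relation.Unary.Unique.Propositional using (Unique)
open import Data.Nat using (ℕ)
open import Data.Product using (∃-syntax; _×_)
open import Data.Rational using (ℚ; _/_)
open import Relation.Binary.PropositionalEquality using (_≡_; _≢_)

-- A subfamily of the k-element subsets of an n-element set, with Fin n as the
-- ground set. It is a duplicate-free enumeration, so its cardinality is the
-- length of the list.
record UniformFamily (n k : ℕ) : Set where
  field
    members : List (Subset n)
    unique  : Unique members
    uniform : ∀ {F} → F ∈ members → ∣ F ∣ ≡ k

open UniformFamily public

infix 4 _∈ᶠ_

_∈ᶠ_ : ∀ {n k} → Subset n → UniformFamily n k → Set
F ∈ᶠ 𝓕 = F ∈ members 𝓕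

card : ∀ {n k} → UniformFamily n k → ℕ
card 𝓕 = length (members 𝓕)

-- F′ ranges over all members, including F itself.
AvoidsTrace : ∀ {n k} → ℕ → UniformFamily n k → Set
AvoidsTrace s 𝓕 =
  ∀ F → F ∈ᶠ 𝓕 →
    ∃[ B ] (B ⊆ F × ∣ B ∣ ≡ s × (∀ F′ → F′ ∈ᶠ 𝓕 → F ∩ F′ ≢ B))

IsStar : ∀ {n k} → UniformFamily n k → Set
IsStar 𝓕 = ∃[ x ] (∀ F → F ∈ᶠ 𝓕 → x ∈ₛ F)

fromℕ : ℕ → ℚ
fromℕ m = + m / 1

{-# OPTIONS --safe #-}
module Submission where

-- Say that x forces y ≢ x when every member containing x contains y. If x
-- forces nothing, then only O(n^(d-2)) members F can have B_F = {x}, so all but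
-- O(n^(d-1)) members contain a forcing element. For such members F ↦ F - y, with
-- y forced by some x ∈ F, is an injection into the d-sets.
--   If no y is forced by almost all points, then a positive proportion of the
-- d-sets are missed by this injection, which gives |𝓕| ≤ C(n,d) - Ω(n^d).
--   If y is forced by all points outside a set R of size at most εn, then the
-- members avoiding y lie in R. Each {x} = B_F of such a member F excludes from 𝓕
-- all {x, y} ∪ E with E outside R, about (n - |R|)^(d-1)/(d-1)! sets, and accounts
-- for at most (d+1)|R|^(d-1) members avoiding y. So either 𝓕 is a star with
-- centre y or Ω(n^(d-1)) sets are lost.

open import Defs
open import Data.Bool using () renaming (_≟_ to _≟ᵇ_)
open import Data.Fin using (Fin; zero; suc; _≟_)
open import Data.Fin.Properties using (any?; suc-injective)
open import Data.Fin.Subset using (Subset; ∣_∣; _⊆_; _∩_; _∪_; _-_; _─_; ⁅_⁆; ∁; inside; outside; ⊤) renaming (_∈_ to _∈ₛ_; _∉_ to _∉ₛ_; ⊥ to ∅)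
open import Data.Fin.Subset.Properties
open import Data.List using (List; []; _∷_; _++_; length; map; filter; concatMap; allFin; deduplicate)
open import Data.List.Membership.Propositional using (_∈_; lose; find)
open import Data.List.Membership.Propositional.Properties
open import Data.List.Properties using (length-++; length-map; length-++-sucʳ; length-tabulate)
open import Data.List.Relation.Binary.Subset.Propositional using () renaming (_⊆_ to _⊆ˡ_)
open import Data.List.Relation.Unary.All as All using (All; []; _∷_; all?)
open import Data.List.Relation.Unary.All.Properties using (¬Any⇒All¬; ¬All⇒Any¬) renaming (map⁺ to All-map⁺)
import Data.List.Relation.Unary.AllPairs as AllPairs
import Data.List.Relation.Unary.AllPairs.Properties as AllPairs
open import Data.List.Relation.Unary.Any as Any using (Any; here; there)
open import Data.List.Relation.Unary.Unique.Propositional using (Unique; []; _∷_)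
open import Data.List.Relation.Unary.Unique.Propositional.Properties using (map⁺; ++⁺; concat⁺; filter⁺; allFin⁺; Unique[x∷xs]⇒x∉xs)
import Data.List.Relation.Unary.Unique.DecPropositional.Properties as DecUnique
open import Data.Nat using (ℕ; zero; suc; _+_; _*_; _^_; _∸_; _≤_; _<_; _≥_; z≤n; s≤s; NonZero; >-nonZero)
open import Data.Nat.Combinatorics using (_C_; nCk+nC[k+1]≡[n+1]C[k+1])
open import Data.Nat.Properties hiding (_≟_; suc-injective)
open import Data.Product using (∃; ∃₂; ∃-syntax; _×_; _,_; proj₁; proj₂)
open import Data.Rational using (ℚ; 0ℚ) renaming (_<_ to _<ℚ_; _≤_ to _≤ℚ_; _*_ to _*ℚ_; _-_ to _-ℚ_)
open import Data.Sum as Sum using (_⊎_; inj₁; inj₂; [_,_]′)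
open import Data.Vec using ([]; _∷_; tabulate; here; there)
open import Data.Vec.Properties using (≡-dec; lookup∘tabulate; lookup⇒[]=; []=⇒lookup; ∷-injectiveʳ)
open import Function using (_∘_; id)
open import Relation.Binary.PropositionalEquality
open import Relation.Nullary using (¬_; Dec; yes; no; does; contradiction)
open import Relation.Nullary.Decidable using (¬?; _×-dec_; _→-dec_; dec-true; decidable-stable)
open import Relation.Unary using (Decidable)

open import Data.Nat.DivMod using (_/_; _%_; m≡m%n+[m/n]*n; m%n<n; m/n*n≤m; m*n/n≡m; /-monoˡ-≤)
open import Data.Nat.Solver using (module +-*-Solver)
import Data.Integer as ℤ
import Data.Integer.Properties as ℤ
import Data.Rational as ℚ
import Data.Rational.Properties as ℚ
import Data.Rational.Unnormalised as ℚᵘ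
import Data.Rational.Unnormalised.Properties as ℚᵘ
private
  variable
    A B : Set
    n : ℕ
    p q F : Subset n
    x y z : Fin n

-- Counting with duplicate-free lists

-- Upper bounds on families are obtained from this by covering them with lists `ys` that may repeat
-- entries.
unique-⊆⇒length≤ : {xs ys : List A} → Unique xs → xs ⊆ˡ ys → length xs ≤ length ys
unique-⊆⇒length≤ [] _ = z≤n
unique-⊆⇒length≤ {xs = x ∷ xs} (x∉xs ∷ !xs) xs⊆ys with ∈-∃++ (xs⊆ys (here refl))
... | as , bs , refl = begin
  suc (length xs)          ≤⟨ s≤s (unique-⊆⇒length≤ !xs xs⊆as++bs) ⟩
  suc (length (as ++ bs))  ≡⟨ length-++-sucʳ as x bs ⟨
  length (as ++ x ∷ bs)    ∎
  where
  open ≤-Reasoning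
  xs⊆as++bs : xs ⊆ˡ as ++ bs
  xs⊆as++bs z∈xs with ∈-++⁻ as (xs⊆ys (there z∈xs))
  ... | inj₁ z∈as         = ∈-++⁺ˡ z∈as
  ... | inj₂ (here refl)  = contradiction refl (All.lookup x∉xs z∈xs)
  ... | inj₂ (there z∈bs) = ∈-++⁺ʳ as z∈bs

length≤filter+filter¬ : {P : A → Set} (P? : Decidable P) {xs : List A} → Unique xs →
  length xs ≤ length (filter P? xs) + length (filter (¬? ∘ P?) xs)
length≤filter+filter¬ P? {xs} !xs = begin
  length xs                                                  ≤⟨ unique-⊆⇒length≤ !xs covered ⟩
  length (filter P? xs ++ filter (¬? ∘ P?) xs)               ≡⟨ length-++ (filter P? xs) ⟩
  length (filter P? xs) + length (filter (¬? ∘ P?) xs)       ∎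
  where
  open ≤-Reasoning
  covered : xs ⊆ˡ filter P? xs ++ filter (¬? ∘ P?) xs
  covered {x} x∈xs with P? x
  ... | yes px = ∈-++⁺ˡ (∈-filter⁺ P? x∈xs px)
  ... | no ¬px = ∈-++⁺ʳ (filter P? xs) (∈-filter⁺ (¬? ∘ P?) x∈xs ¬px)

∈-concatMap-intro : (f : A → List B) {xs : List A} {a : A} {b : B} → a ∈ xs → b ∈ f a → b ∈ concatMap f xs
∈-concatMap-intro f a∈xs b∈fa = ∈-concatMap⁺ f (lose a∈xs b∈fa)

length-concatMap-≤ : (f : A → List B) {m : ℕ} (xs : List A) →
  (∀ {a} → a ∈ xs → length (f a) ≤ m) → length (concatMap f xs) ≤ length xs * m
length-concatMap-≤ f []       f≤ = z≤n
length-concatMap-≤ f {m} (x ∷ xs) f≤ = begin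
  length (f x ++ concatMap f xs)          ≡⟨ length-++ (f x) ⟩
  length (f x) + length (concatMap f xs)  ≤⟨ +-mono-≤ (f≤ (here refl)) (length-concatMap-≤ f xs (f≤ ∘ there)) ⟩
  m + length xs * m                       ∎
  where open ≤-Reasoning

length-concatMap-≥ : (f : A → List B) {m : ℕ} (xs : List A) →
  (∀ {a} → a ∈ xs → m ≤ length (f a)) → length xs * m ≤ length (concatMap f xs)
length-concatMap-≥ f []       f≥ = z≤n
length-concatMap-≥ f {m} (x ∷ xs) f≥ = begin
  m + length xs * m                       ≤⟨ +-mono-≤ (f≥ (here refl)) (length-concatMap-≥ f xs (f≥ ∘ there)) ⟩
  length (f x) + length (concatMap f xs)  ≡⟨ length-++ (f x) ⟨
  length (f x ++ concatMap f xs)          ∎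
  where open ≤-Reasoning

dependentPairs : (A → List B) → List A → List (A × B)
dependentPairs f = concatMap (λ a → map (a ,_) (f a))

∈-dependentPairs⁻ : (f : A → List B) (xs : List A) {a : A} {b : B} →
  (a , b) ∈ dependentPairs f xs → a ∈ xs × b ∈ f a
∈-dependentPairs⁻ f xs ab∈ with find (∈-concatMap⁻ (λ a → map (a ,_) (f a)) {xs = xs} ab∈)
... | a , a∈xs , ab∈map with ∈-map⁻ (a ,_) ab∈map
... | b , b∈fa , refl = a∈xs , b∈fa

dependentPairs-unique : (f : A → List B) {xs : List A} →
  Unique xs → (∀ {a} → a ∈ xs → Unique (f a)) → Unique (dependentPairs f xs)
dependentPairs-unique f {xs} !xs !f = concat⁺
  (All-map⁺ (All.tabulate (map⁺ ,-injectiveʳ′ ∘ !f)))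
  (AllPairs.map⁺ (AllPairs.map disjoint !xs))
  where
  ,-injectiveʳ′ : ∀ {a b b′} → (a , b) ≡ (a , b′) → b ≡ b′
  ,-injectiveʳ′ refl = refl
  disjoint : ∀ {a a′} → a ≢ a′ → ∀ {c} → ¬ (c ∈ map (a ,_) (f a) × c ∈ map (a′ ,_) (f a′))
  disjoint a≢a′ (c∈ , c∈′) with ∈-map⁻ _ c∈ | ∈-map⁻ _ c∈′
  ... | _ , _ , refl | _ , _ , refl = a≢a′ refl

length-dependentPairs : (f : A → List B) {m : ℕ} (xs : List A) →
  (∀ {a} → a ∈ xs → m ≤ length (f a)) → length xs * m ≤ length (dependentPairs f xs)
length-dependentPairs f xs f≥ = length-concatMap-≥ _ xs
  λ {a} a∈xs → ≤-trans (f≥ a∈xs) (≤-reflexive (sym (length-map (a ,_) (f a))))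

-- A relation replaces a function because an image such as `F - y` depends on a choice of a forcing
-- pair; the last component hands such a pair back to later arguments. As injectivity holds across
-- all possible images, the chosen ones are distinct.
unique-image : (R : A → B → Set) {xs : List A} → Unique xs →
  (∀ {a} → a ∈ xs → ∃ (R a)) →
  (∀ {a a′ b} → a ∈ xs → a′ ∈ xs → R a b → R a′ b → a ≡ a′) →
  ∃[ ys ] (Unique ys × length ys ≡ length xs × (∀ {b} → b ∈ ys → ∃[ a ] (a ∈ xs × R a b)))
unique-image R [] total inj = [] , [] , refl , λ ()
unique-image R {x ∷ xs} !!xs@(_ ∷ !xs) total inj
  with unique-image R !xs (total ∘ there) (λ a∈ a′∈ → inj (there a∈) (there a′∈)) | total (here refl)
... | ys , !ys , eq , back | y , Rxy = y ∷ ys , ¬Any⇒All¬ ys y∉ys ∷ !ys , cong suc eq , back′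
  where
  y∉ys : ¬ (y ∈ ys)
  y∉ys y∈ys with back y∈ys
  ... | a , a∈xs , Ray with inj (here refl) (there a∈xs) Rxy Ray
  ... | refl = Unique[x∷xs]⇒x∉xs !!xs a∈xs
  back′ : ∀ {b} → b ∈ y ∷ ys → ∃[ a ] (a ∈ x ∷ xs × R a b)
  back′ (here refl) = x , here refl , Rxy
  back′ (there b∈ys) with back b∈ys
  ... | a , a∈xs , Rab = a , there a∈xs , Rab

-- Finite subsets

⟦_⟧ : {P : Fin n → Set} → Decidable P → Subset n
⟦ P? ⟧ = tabulate (does ∘ P?)

∈⟦⟧⁺ : {P : Fin n → Set} (P? : Decidable P) → P x → x ∈ₛ ⟦ P? ⟧
∈⟦⟧⁺ {x = x} P? px = lookup⇒[]= x _ (trans (lookup∘tabulate (does ∘ P?) x) (dec-true (P? x) px))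

∈⟦⟧⁻ : {P : Fin n → Set} (P? : Decidable P) → x ∈ₛ ⟦ P? ⟧ → P x
∈⟦⟧⁻ {x = x} P? x∈ with P? x | trans (sym (lookup∘tabulate (does ∘ P?) x)) ([]=⇒lookup x∈)
... | yes px | _ = px
... | no _   | ()

x∈p─q⇒x∉q : ∀ (p q : Subset n) → x ∈ₛ p ─ q → x ∉ₛ q
x∈p─q⇒x∉q (_ ∷ p) (outside ∷ q) (there x∈) (there x∈q) = x∈p─q⇒x∉q p q x∈ x∈q
x∈p─q⇒x∉q (_ ∷ p) (inside ∷ q)  (there x∈) (there x∈q) = x∈p─q⇒x∉q p q x∈ x∈q

x∈p-y⁻ : ∀ (p : Subset n) y → x ∈ₛ p - y → x ∈ₛ p × x ≢ y
x∈p-y⁻ p y x∈ = p─q⊆p p ⁅ y ⁆ x∈ , x∉⁅y⁆⇒x≢y (x∈p─q⇒x∉q p ⁅ y ⁆ x∈)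

x∈p∪⁅y⁆⁻ : x ∈ₛ p ∪ ⁅ y ⁆ → x ∈ₛ p ⊎ x ≡ y
x∈p∪⁅y⁆⁻ {p = p} {y = y} x∈ with x∈p∪q⁻ p ⁅ y ⁆ x∈
... | inj₁ x∈p = inj₁ x∈p
... | inj₂ x∈y = inj₂ (x∈⁅y⁆⇒x≡y y x∈y)

y∈p∪⁅y⁆ : y ∈ₛ p ∪ ⁅ y ⁆
y∈p∪⁅y⁆ {y = y} = x∈p∪q⁺ (inj₂ (x∈⁅x⁆ y))

p∪⁅x⁆⊆q : p ⊆ q → x ∈ₛ q → p ∪ ⁅ x ⁆ ⊆ q
p∪⁅x⁆⊆q p⊆q x∈q z∈ with x∈p∪⁅y⁆⁻ z∈
... | inj₁ z∈p  = p⊆q z∈p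
... | inj₂ refl = x∈q

∣p∪⁅x⁆∣ : x ∉ₛ p → ∣ p ∪ ⁅ x ⁆ ∣ ≡ suc ∣ p ∣
∣p∪⁅x⁆∣ {x = zero}  {p = outside ∷ p} x∉p = cong (λ r → suc ∣ r ∣) (∪-identityʳ p)
∣p∪⁅x⁆∣ {x = zero}  {p = inside ∷ p}  x∉p = contradiction here x∉p
∣p∪⁅x⁆∣ {x = suc x} {p = outside ∷ p} x∉p = ∣p∪⁅x⁆∣ (x∉p ∘ there)
∣p∪⁅x⁆∣ {x = suc x} {p = inside ∷ p}  x∉p = cong suc (∣p∪⁅x⁆∣ (x∉p ∘ there))

[p-x]∪⁅x⁆≡p : x ∈ₛ p → (p - x) ∪ ⁅ x ⁆ ≡ p
[p-x]∪⁅x⁆≡p {x = x} {p = p} x∈p = ⊆-antisym (p∪⁅x⁆⊆q (proj₁ ∘ x∈p-y⁻ p x) x∈p) p⊆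
  where
  p⊆ : p ⊆ (p - x) ∪ ⁅ x ⁆
  p⊆ {z} z∈p with z ≟ x
  ... | yes refl = y∈p∪⁅y⁆
  ... | no z≢x   = x∈p∪q⁺ (inj₁ (x∈p∧x≢y⇒x∈p-y z∈p z≢x))

[p∪⁅x⁆]-x≡p : x ∉ₛ p → (p ∪ ⁅ x ⁆) - x ≡ p
[p∪⁅x⁆]-x≡p {x = x} {p = p} x∉p = ⊆-antisym left right
  where
  left : (p ∪ ⁅ x ⁆) - x ⊆ p
  left z∈ with x∈p-y⁻ (p ∪ ⁅ x ⁆) x z∈
  ... | z∈∪ , z≢x with x∈p∪⁅y⁆⁻ z∈∪
  ...   | inj₁ z∈p = z∈p
  ...   | inj₂ z≡x = contradiction z≡x z≢x
  right : p ⊆ (p ∪ ⁅ x ⁆) - x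
  right z∈p = x∈p∧x≢y⇒x∈p-y (x∈p∪q⁺ (inj₁ z∈p)) λ { refl → x∉p z∈p }

∣p∣≡1+∣p-x∣ : x ∈ₛ p → ∣ p ∣ ≡ suc ∣ p - x ∣
∣p∣≡1+∣p-x∣ {x = x} {p = p} x∈p = trans (cong ∣_∣ (sym ([p-x]∪⁅x⁆≡p x∈p)))
  (∣p∪⁅x⁆∣ {p = p - x} λ x∈ → proj₂ (x∈p-y⁻ p x x∈) refl)

∣p∪q∣≤∣p∣+∣q∣ : ∀ (p q : Subset n) → ∣ p ∪ q ∣ ≤ ∣ p ∣ + ∣ q ∣
∣p∪q∣≤∣p∣+∣q∣ []            []            = z≤n
∣p∪q∣≤∣p∣+∣q∣ (outside ∷ p) (outside ∷ q) = ∣p∪q∣≤∣p∣+∣q∣ p q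
∣p∪q∣≤∣p∣+∣q∣ (inside ∷ p)  (outside ∷ q) = s≤s (∣p∪q∣≤∣p∣+∣q∣ p q)
∣p∪q∣≤∣p∣+∣q∣ (outside ∷ p) (inside ∷ q)  =
  ≤-trans (s≤s (∣p∪q∣≤∣p∣+∣q∣ p q)) (≤-reflexive (sym (+-suc ∣ p ∣ ∣ q ∣)))
∣p∪q∣≤∣p∣+∣q∣ (inside ∷ p)  (inside ∷ q)  =
  s≤s (≤-trans (∣p∪q∣≤∣p∣+∣q∣ p q) (+-monoʳ-≤ ∣ p ∣ (n≤1+n ∣ q ∣)))

∣p∪⁅x⁆∣≤ : ∀ (p : Subset n) x → ∣ p ∪ ⁅ x ⁆ ∣ ≤ suc ∣ p ∣
∣p∪⁅x⁆∣≤ p x = begin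
  ∣ p ∪ ⁅ x ⁆ ∣      ≤⟨ ∣p∪q∣≤∣p∣+∣q∣ p ⁅ x ⁆ ⟩
  ∣ p ∣ + ∣ ⁅ x ⁆ ∣  ≡⟨ cong (∣ p ∣ +_) (∣⁅x⁆∣≡1 x) ⟩
  ∣ p ∣ + 1          ≡⟨ +-comm ∣ p ∣ 1 ⟩
  suc ∣ p ∣          ∎
  where open ≤-Reasoning

∣p∣<∣q∣⇒∃∈q∖p : ∣ p ∣ < ∣ q ∣ → ∃[ x ] (x ∈ₛ q × x ∉ₛ p)
∣p∣<∣q∣⇒∃∈q∖p {p = p} {q = q} p<q with any? (λ x → (x ∈? q) ×-dec ¬? (x ∈? p))
... | yes ∃x = ∃x
... | no ∄x  = contradiction (p⊆q⇒∣p∣≤∣q∣ q⊆p) (<⇒≱ p<q)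
  where
  q⊆p : q ⊆ p
  q⊆p {x} x∈q = decidable-stable (x ∈? p) λ x∉p → ∄x (x , x∈q , x∉p)

⊆∧∣∣≡⇒≡ : p ⊆ q → ∣ q ∣ ≡ ∣ p ∣ → p ≡ q
⊆∧∣∣≡⇒≡ {p = p} {q = q} p⊆q eq = ⊆-antisym p⊆q λ {x} x∈q → decidable-stable (x ∈? p)
  λ x∉p → <-irrefl (sym eq) (p⊂q⇒∣p∣<∣q∣ (p⊆q , x , x∈q , x∉p))

elements : Subset n → List (Fin n)
elements []            = []
elements (outside ∷ p) = map suc (elements p)
elements (inside ∷ p)  = zero ∷ map suc (elements p)

length-elements : ∀ (p : Subset n) → length (elements p) ≡ ∣ p ∣
length-elements []            = refl
length-elements (outside ∷ p) = trans (length-map suc (elements p)) (length-elements p)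
length-elements (inside ∷ p)  = cong suc (trans (length-map suc (elements p)) (length-elements p))

∈-elements⁺ : x ∈ₛ p → x ∈ elements p
∈-elements⁺ {p = inside ∷ p}  here        = here refl
∈-elements⁺ {p = outside ∷ p} (there x∈p) = ∈-map⁺ suc (∈-elements⁺ x∈p)
∈-elements⁺ {p = inside ∷ p}  (there x∈p) = there (∈-map⁺ suc (∈-elements⁺ x∈p))

∈-elements⁻ : x ∈ elements p → x ∈ₛ p
∈-elements⁻ {p = outside ∷ p} x∈ with ∈-map⁻ suc x∈
... | _ , y∈ , refl = there (∈-elements⁻ y∈)
∈-elements⁻ {p = inside ∷ p} (here refl) = here
∈-elements⁻ {p = inside ∷ p} (there x∈) with ∈-map⁻ suc x∈
... | _ , y∈ , refl = there (∈-elements⁻ y∈)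

elements-unique : ∀ (p : Subset n) → Unique (elements p)
elements-unique []            = []
elements-unique (outside ∷ p) = map⁺ suc-injective (elements-unique p)
elements-unique (inside ∷ p)  = All-map⁺ (All.tabulate λ _ ()) ∷ map⁺ suc-injective (elements-unique p)

subsetsOf : Subset n → ℕ → List (Subset n)
subsetsOf []            zero    = [] ∷ []
subsetsOf []            (suc k) = []
subsetsOf (outside ∷ p) k       = map (outside ∷_) (subsetsOf p k)
subsetsOf (inside ∷ p)  zero    = map (outside ∷_) (subsetsOf p zero)
subsetsOf (inside ∷ p)  (suc k) = map (inside ∷_) (subsetsOf p k) ++ map (outside ∷_) (subsetsOf p (suc k))

length-subsetsOf : ∀ (p : Subset n) k → length (subsetsOf p k) ≡ ∣ p ∣ C k
length-subsetsOf []            zero    = refl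
length-subsetsOf []            (suc k) = refl
length-subsetsOf (outside ∷ p) k       = trans (length-map _ (subsetsOf p k)) (length-subsetsOf p k)
length-subsetsOf (inside ∷ p)  zero    =
  trans (length-map _ (subsetsOf p 0)) (length-subsetsOf p 0)
length-subsetsOf (inside ∷ p)  (suc k) = begin
  length (map (inside ∷_) (subsetsOf p k) ++ map (outside ∷_) (subsetsOf p (suc k)))
    ≡⟨ length-++ (map (inside ∷_) (subsetsOf p k)) ⟩
  length (map (inside ∷_) (subsetsOf p k)) + length (map (outside ∷_) (subsetsOf p (suc k)))
    ≡⟨ cong₂ _+_ (length-map _ (subsetsOf p k)) (length-map _ (subsetsOf p (suc k))) ⟩
  length (subsetsOf p k) + length (subsetsOf p (suc k))
    ≡⟨ cong₂ _+_ (length-subsetsOf p k) (length-subsetsOf p (suc k)) ⟩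
  ∣ p ∣ C k + ∣ p ∣ C suc k
    ≡⟨ nCk+nC[k+1]≡[n+1]C[k+1] ∣ p ∣ k ⟩
  suc ∣ p ∣ C suc k ∎
  where open ≡-Reasoning

∈-subsetsOf⁺ : q ⊆ p → q ∈ subsetsOf p ∣ q ∣
∈-subsetsOf⁺ {q = []}          {p = []}          q⊆p = here refl
∈-subsetsOf⁺ {q = outside ∷ q} {p = outside ∷ p} q⊆p = ∈-map⁺ _ (∈-subsetsOf⁺ (drop-∷-⊆ q⊆p))
∈-subsetsOf⁺ {q = inside ∷ q}  {p = outside ∷ p} q⊆p with q⊆p here
... | ()
∈-subsetsOf⁺ {q = outside ∷ q} {p = inside ∷ p}  q⊆p with ∣ q ∣ | ∈-subsetsOf⁺ (drop-∷-⊆ q⊆p)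
... | zero  | q∈ = ∈-map⁺ _ q∈
... | suc k | q∈ = ∈-++⁺ʳ (map (inside ∷_) (subsetsOf p k)) (∈-map⁺ _ q∈)
∈-subsetsOf⁺ {q = inside ∷ q}  {p = inside ∷ p}  q⊆p = ∈-++⁺ˡ (∈-map⁺ _ (∈-subsetsOf⁺ (drop-∷-⊆ q⊆p)))

∈-subsetsOf⁻ : ∀ (p : Subset n) k → q ∈ subsetsOf p k → q ⊆ p × ∣ q ∣ ≡ k
∈-subsetsOf⁻ []            zero    (here refl) = id , refl
∈-subsetsOf⁻ (outside ∷ p) k       q∈ with ∈-map⁻ _ q∈
... | _ , r∈ , refl with ∈-subsetsOf⁻ p k r∈
...   | r⊆p , eq = s⊆s r⊆p , eq
∈-subsetsOf⁻ (inside ∷ p)  zero    q∈ with ∈-map⁻ _ q∈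
... | _ , r∈ , refl with ∈-subsetsOf⁻ p 0 r∈
...   | r⊆p , eq = out⊆ r⊆p , eq
∈-subsetsOf⁻ (inside ∷ p)  (suc k) q∈ with ∈-++⁻ (map (inside ∷_) (subsetsOf p k)) q∈
∈-subsetsOf⁻ (inside ∷ p)  (suc k) q∈ | inj₁ q∈ˡ with ∈-map⁻ _ q∈ˡ
... | _ , r∈ , refl with ∈-subsetsOf⁻ p k r∈
...   | r⊆p , eq = in⊆in r⊆p , cong suc eq
∈-subsetsOf⁻ (inside ∷ p)  (suc k) q∈ | inj₂ q∈ʳ with ∈-map⁻ _ q∈ʳ
... | _ , r∈ , refl with ∈-subsetsOf⁻ p (suc k) r∈
...   | r⊆p , eq = out⊆ r⊆p , eq

subsetsOf-unique : ∀ (p : Subset n) k → Unique (subsetsOf p k)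
subsetsOf-unique []            zero    = [] ∷ []
subsetsOf-unique []            (suc k) = []
subsetsOf-unique (outside ∷ p) k       = map⁺ ∷-injectiveʳ (subsetsOf-unique p k)
subsetsOf-unique (inside ∷ p)  zero    = map⁺ ∷-injectiveʳ (subsetsOf-unique p zero)
subsetsOf-unique (inside ∷ p)  (suc k) = ++⁺
  (map⁺ ∷-injectiveʳ (subsetsOf-unique p k))
  (map⁺ ∷-injectiveʳ (subsetsOf-unique p (suc k)))
  disjoint
  where
  disjoint : ∀ {r} → ¬ (r ∈ map (inside ∷_) (subsetsOf p k) × r ∈ map (outside ∷_) (subsetsOf p (suc k)))
  disjoint (r∈ , r∈′) with ∈-map⁻ _ r∈ | ∈-map⁻ _ r∈′
  ... | _ , _ , refl | _ , _ , ()

-- Points are added in every order and may already lie in `p`, so entries repeat and may be too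
-- small. This crude cover has the simple bound `length xs ^ j`, and only upper bounds are taken
-- from it.
extensions : List (Fin n) → Subset n → ℕ → List (Subset n)
extensions xs p zero    = p ∷ []
extensions xs p (suc j) = concatMap (λ x → extensions xs (p ∪ ⁅ x ⁆) j) xs

length-extensions : ∀ (xs : List (Fin n)) p j → length (extensions xs p j) ≤ length xs ^ j
length-extensions xs p zero    = ≤-refl
length-extensions xs p (suc j) = length-concatMap-≤ _ xs λ {x} _ → length-extensions xs (p ∪ ⁅ x ⁆) j

-- For `suc j` the set `F` is larger than `p`, so a point of `F` outside `p` can be added to `p`
-- while keeping it inside `F`.
∈-extensions : ∀ {xs : List (Fin n)} {p F} j → p ⊆ F → (∀ {x} → x ∈ₛ F → x ∉ₛ p → x ∈ xs) →
  ∣ F ∣ ≡ j + ∣ p ∣ → F ∈ extensions xs p j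
∈-extensions zero    p⊆F F⊆ eq = here (sym (⊆∧∣∣≡⇒≡ p⊆F eq))
∈-extensions {xs = xs} {p} (suc j) p⊆F F⊆ eq
  with ∣p∣<∣q∣⇒∃∈q∖p (≤-trans (s≤s (m≤n+m ∣ p ∣ j)) (≤-reflexive (sym eq)))
... | x , x∈F , x∉p = ∈-concatMap-intro _ (F⊆ x∈F x∉p)
  (∈-extensions j (p∪⁅x⁆⊆q p⊆F x∈F) (λ z∈F z∉ → F⊆ z∈F (z∉ ∘ x∈p∪q⁺ ∘ inj₁))
    (trans eq (trans (sym (+-suc j ∣ p ∣)) (cong (j +_) (sym (∣p∪⁅x⁆∣ x∉p))))))

-- Binomial coefficients

C-monoˡ-suc : ∀ m k → m C k ≤ suc m C k
C-monoˡ-suc m zero    = ≤-refl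
C-monoˡ-suc m (suc k) = ≤-trans (m≤n+m (m C suc k) (m C k)) (≤-reflexive (nCk+nC[k+1]≡[n+1]C[k+1] m k))

C-monoˡ : ∀ {m m′} k → m ≤ m′ → m C k ≤ m′ C k
C-monoˡ {m} k m≤m′ with ≤⇒≤′ m≤m′
... | m≤′m′ = go m≤′m′
  where
  open import Data.Nat using (_≤′_; ≤′-reflexive; ≤′-step)
  go : ∀ {m′} → m ≤′ m′ → m C k ≤ m′ C k
  go (≤′-reflexive refl) = ≤-refl
  go (≤′-step m≤′)       = ≤-trans (go m≤′) (C-monoˡ-suc _ k)

-- Pascal's rule is applied `t` times, and each application contributes a term of at least `m C k`.
t*mCk≤[t+m]C[k+1] : ∀ t m k → t * (m C k) ≤ (t + m) C suc k
t*mCk≤[t+m]C[k+1] zero    m k = z≤n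
t*mCk≤[t+m]C[k+1] (suc t) m k = begin
  m C k + t * (m C k)            ≤⟨ +-mono-≤ (C-monoˡ k (m≤n+m m t)) (t*mCk≤[t+m]C[k+1] t m k) ⟩
  (t + m) C k + (t + m) C suc k  ≡⟨ nCk+nC[k+1]≡[n+1]C[k+1] (t + m) k ⟩
  suc (t + m) C suc k            ∎
  where open ≤-Reasoning

-- Among `k` disjoint blocks of `t` points there are `t ^ k` ways to take one point from each; the
-- induction splits off one block at a time.
t^k≤mCk : ∀ t k {m} → k * t ≤ m → t ^ k ≤ m C k
t^k≤mCk t zero    kt≤m = ≤-refl
t^k≤mCk t (suc k) kt≤m = begin
  t * t ^ k               ≤⟨ *-monoʳ-≤ t (t^k≤mCk t k ≤-refl) ⟩
  t * ((k * t) C k)       ≤⟨ t*mCk≤[t+m]C[k+1] t (k * t) k ⟩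
  (t + k * t) C suc k     ≤⟨ C-monoˡ (suc k) kt≤m ⟩
  _                       ∎
  where open ≤-Reasoning

mCk≤m^k : ∀ m k → m C k ≤ m ^ k
mCk≤m^k m       zero    = ≤-refl
mCk≤m^k zero    (suc k) = z≤n
mCk≤m^k (suc m) (suc k) = begin
  suc m C suc k        ≡⟨ nCk+nC[k+1]≡[n+1]C[k+1] m k ⟨
  m C k + m C suc k    ≤⟨ +-mono-≤ (mCk≤m^k m k) (mCk≤m^k m (suc k)) ⟩
  suc m * m ^ k        ≤⟨ *-monoʳ-≤ (suc m) (^-monoˡ-≤ k (n≤1+n m)) ⟩
  suc m * suc m ^ k    ∎
  where open ≤-Reasoning

-- Forcing and pivots

-- It allows a bound to be proved relative to a fixed entry of the list, such as the member `F₀`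
-- below.
length≤-if-inhabited : (xs : List A) {m : ℕ} → (∀ {a} → a ∈ xs → length xs ≤ m) → length xs ≤ m
length≤-if-inhabited []       h = z≤n
length≤-if-inhabited (x ∷ xs) h = h (here refl)

module Traces {n k : ℕ} (𝓕 : UniformFamily n k) where

  -- The condition `y ≢ x` ensures that `F - y` still contains the forcing point `x`. A point in no
  -- member forces all other points vacuously.
  Forces : Fin n → Fin n → Set
  Forces x y = y ≢ x × All (λ F → x ∈ₛ F → y ∈ₛ F) (members 𝓕)

  forces? : ∀ x y → Dec (Forces x y)
  forces? x y = ¬? (y ≟ x) ×-dec all? (λ F → (x ∈? F) →-dec (y ∈? F)) (members 𝓕)

  forces-trans : ∀ {x y z} → Forces x y → Forces y z → z ≢ x → Forces x z
  forces-trans (_ , x→y) (_ , y→z) z≢x =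
    z≢x , All.tabulate λ F∈𝓕 x∈F → All.lookup y→z F∈𝓕 (All.lookup x→y F∈𝓕 x∈F)

  -- Despite the name, `x` is the point that forces here, not the one that is forced; likewise for
  -- `unforced` below.
  Forced : Fin n → Set
  Forced x = ∃ (Forces x)

  forced? : ∀ x → Dec (Forced x)
  forced? x = any? (forces? x)

  MeetsForced : Subset n → Set
  MeetsForced F = ∃[ x ] (x ∈ₛ F × Forced x)

  meetsForced? : ∀ F → Dec (MeetsForced F)
  meetsForced? F = any? λ x → (x ∈? F) ×-dec forced? x

  -- Pivot x F says that {x} is a valid choice of B_F.
  Pivot : Fin n → Subset n → Set
  Pivot x F = x ∈ₛ F × All (λ F′ → x ∈ₛ F′ → ∃[ z ] (z ≢ x × z ∈ₛ F × z ∈ₛ F′)) (members 𝓕)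

  pivot? : ∀ x F → Dec (Pivot x F)
  pivot? x F = (x ∈? F) ×-dec all?
    (λ F′ → (x ∈? F′) →-dec any? λ z → ¬? (z ≟ x) ×-dec ((z ∈? F) ×-dec (z ∈? F′))) (members 𝓕)

  -- `B` is a singleton `{x}`. If `F′` contains `x`, then `F ∩ F′` contains `x` and differs from
  -- `B`, so it has a second element.
  pivot-exists : AvoidsTrace 1 𝓕 → F ∈ᶠ 𝓕 → ∃[ x ] Pivot x F
  pivot-exists {F} avoids F∈𝓕 with avoids F F∈𝓕
  ... | B , B⊆F , ∣B∣≡1 , F∩≢B
    with ∣p∣<∣q∣⇒∃∈q∖p {p = ∅} {q = B} (≤-reflexive (trans (cong suc (∣⊥∣≡0 n)) (sym ∣B∣≡1)))
  ...   | x , x∈B , _ = x , B⊆F x∈B , All.tabulate second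
    where
    ⁅x⁆≡B : ⁅ x ⁆ ≡ B
    ⁅x⁆≡B = ⊆∧∣∣≡⇒≡ (λ z∈ → subst (_∈ₛ B) (sym (x∈⁅y⁆⇒x≡y x z∈)) x∈B) (trans ∣B∣≡1 (sym (∣⁅x⁆∣≡1 x)))
    second : ∀ {F′} → F′ ∈ members 𝓕 → x ∈ₛ F′ → ∃[ z ] (z ≢ x × z ∈ₛ F × z ∈ₛ F′)
    second {F′} F′∈𝓕 x∈F′ with any? (λ z → ¬? (z ≟ x) ×-dec ((z ∈? F) ×-dec (z ∈? F′)))
    ... | yes ∃z = ∃z
    ... | no ∄z  = contradiction (trans (⊆-antisym ⊆⁅x⁆ ⁅x⁆⊆) ⁅x⁆≡B) (F∩≢B F′ F′∈𝓕)
      where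
      ⊆⁅x⁆ : F ∩ F′ ⊆ ⁅ x ⁆
      ⊆⁅x⁆ {z} z∈ with z ≟ x | x∈p∩q⁻ F F′ z∈
      ... | yes refl | _          = x∈⁅x⁆ x
      ... | no z≢x   | z∈F , z∈F′ = contradiction (z , z≢x , z∈F , z∈F′) ∄z
      ⁅x⁆⊆ : ⁅ x ⁆ ⊆ F ∩ F′
      ⁅x⁆⊆ z∈ with x∈⁅y⁆⇒x≡y x z∈
      ... | refl = x∈p∩q⁺ (B⊆F x∈B , x∈F′)

  length-elements-member : F ∈ᶠ 𝓕 → length (elements F) ≡ k
  length-elements-member {F} F∈𝓕 = trans (length-elements F) (uniform 𝓕 F∈𝓕)

∣pair∣ : z ≢ x → ∣ ⁅ x ⁆ ∪ ⁅ z ⁆ ∣ ≡ 2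
∣pair∣ {x = x} z≢x = trans (∣p∪⁅x⁆∣ (x≢y⇒x∉⁅y⁆ z≢x)) (cong suc (∣⁅x⁆∣≡1 x))

∣triple∣ : z ≢ x → y ≢ x → y ≢ z → ∣ ⁅ x ⁆ ∪ ⁅ z ⁆ ∪ ⁅ y ⁆ ∣ ≡ 3
∣triple∣ {z = z} {x = x} {y = y} z≢x y≢x y≢z = trans
  (cong ∣_∣ (sym (∪-assoc ⁅ x ⁆ ⁅ z ⁆ ⁅ y ⁆)))
  (trans (∣p∪⁅x⁆∣ λ y∈ → [ (λ y∈x → y≢x (x∈⁅y⁆⇒x≡y x y∈x)) , y≢z ]′ (x∈p∪⁅y⁆⁻ y∈)) (cong suc (∣pair∣ z≢x)))

⁅x⁆⊆ : x ∈ₛ p → ⁅ x ⁆ ⊆ p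
⁅x⁆⊆ {x = x} x∈p z∈ with x∈⁅y⁆⇒x≡y x z∈
... | refl = x∈p

-- Members without a forcing point

module _ {n e : ℕ} (𝓕 : UniformFamily n (3 + e)) where
  open Traces 𝓕

  -- Members with pivot x all meet a fixed one, F₀, in some z ≢ x; as z is not
  -- forced by x, they also meet a member containing x but not z. So they
  -- contain one of boundedly many triples.
  pivots-unforced : ∀ x → ¬ Forced x →
    length (filter (pivot? x) (members 𝓕)) ≤ (3 + e) * ((3 + e) * n ^ e)
  pivots-unforced x unforced = length≤-if-inhabited (filter (pivot? x) (members 𝓕)) bound
    where
    bound : ∀ {F₀} → F₀ ∈ filter (pivot? x) (members 𝓕) →
      length (filter (pivot? x) (members 𝓕)) ≤ (3 + e) * ((3 + e) * n ^ e)
    bound {F₀} F₀∈ = begin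
      length (filter (pivot? x) (members 𝓕))
        ≤⟨ unique-⊆⇒length≤ (filter⁺ (pivot? x) (unique 𝓕)) covered ⟩
      length (concatMap cover₁ (elements F₀))
        ≤⟨ length-concatMap-≤ cover₁ (elements F₀) (λ {z} _ → cover₁-≤ z) ⟩
      length (elements F₀) * ((3 + e) * n ^ e)
        ≡⟨ cong (_* ((3 + e) * n ^ e)) (length-elements-member F₀∈𝓕) ⟩
      (3 + e) * ((3 + e) * n ^ e) ∎
      where
      open ≤-Reasoning
      F₀∈𝓕 = proj₁ (∈-filter⁻ (pivot? x) {xs = members 𝓕} F₀∈)
      x∈F₀ = proj₁ (proj₂ (∈-filter⁻ (pivot? x) {xs = members 𝓕} F₀∈))
      missing : ∀ z → ∃[ G ] (G ∈ᶠ 𝓕 × (z ≢ x → x ∈ₛ G × z ∉ₛ G))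
      missing z with z ≟ x
      -- No member contains `x` and misses it, so `F₀` is a default value here and no separation is
      -- claimed.
      ... | yes z≡x = F₀ , F₀∈𝓕 , λ z≢x → contradiction z≡x z≢x
      ... | no z≢x with all? (λ F → (x ∈? F) →-dec (z ∈? F)) (members 𝓕)
      ...   | yes x→z = contradiction (z , z≢x , x→z) unforced
      ...   | no ¬x→z with find (¬All⇒Any¬ (λ F → (x ∈? F) →-dec (z ∈? F)) (members 𝓕) ¬x→z)
      ...     | G , G∈𝓕 , ¬imp = G , G∈𝓕 , λ _ →
        decidable-stable (x ∈? G) (λ x∉G → ¬imp λ x∈G → contradiction x∈G x∉G) , λ z∈G → ¬imp λ _ → z∈G
      -- Beyond `x`, `z` and `w` the remaining `e` points are arbitrary, which gives the factor
      -- `n ^ e`.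
      cover₂ : Fin n → Fin n → List (Subset n)
      cover₂ z w = extensions (allFin n) (⁅ x ⁆ ∪ ⁅ z ⁆ ∪ ⁅ w ⁆) e
      cover₁ : Fin n → List (Subset n)
      cover₁ z = concatMap (cover₂ z) (elements (proj₁ (missing z)))
      cover₁-≤ : ∀ z → length (cover₁ z) ≤ (3 + e) * n ^ e
      cover₁-≤ z = begin
        length (cover₁ z)
          ≤⟨ length-concatMap-≤ (cover₂ z) (elements (proj₁ (missing z)))
               (λ {w} _ → length-extensions (allFin n) (⁅ x ⁆ ∪ ⁅ z ⁆ ∪ ⁅ w ⁆) e) ⟩
        length (elements (proj₁ (missing z))) * length (allFin n) ^ e
          ≡⟨ cong₂ (λ a b → a * b ^ e) (length-elements-member (proj₁ (proj₂ (missing z)))) (length-tabulate id) ⟩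
        (3 + e) * n ^ e ∎
      covered : filter (pivot? x) (members 𝓕) ⊆ˡ concatMap cover₁ (elements F₀)
      covered {F} F∈ with ∈-filter⁻ (pivot? x) {xs = members 𝓕} F∈
      ... | F∈𝓕 , x∈F , meets with All.lookup meets F₀∈𝓕 x∈F₀
      ... | z , z≢x , z∈F , z∈F₀ with proj₂ (proj₂ (missing z)) z≢x
      ... | x∈G , z∉G with All.lookup meets (proj₁ (proj₂ (missing z))) x∈G
      ... | w , w≢x , w∈F , w∈G =
        ∈-concatMap-intro cover₁ (∈-elements⁺ z∈F₀) (∈-concatMap-intro (cover₂ z) (∈-elements⁺ w∈G)
          (∈-extensions e triple⊆F (λ _ _ → ∈-allFin _) (trans (uniform 𝓕 F∈𝓕) (trans (+-comm 3 e) (cong (e +_) (sym ∣P∣≡3))))))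
        where
        ∣P∣≡3 : ∣ ⁅ x ⁆ ∪ ⁅ z ⁆ ∪ ⁅ w ⁆ ∣ ≡ 3
        -- `w` lies in the member chosen to miss `z`, so the two points differ.
        ∣P∣≡3 = ∣triple∣ z≢x w≢x λ { refl → z∉G w∈G }
        triple⊆F : ⁅ x ⁆ ∪ ⁅ z ⁆ ∪ ⁅ w ⁆ ⊆ F
        triple⊆F = subst (_⊆ F) (∪-assoc ⁅ x ⁆ ⁅ z ⁆ ⁅ w ⁆) (p∪⁅x⁆⊆q (p∪⁅x⁆⊆q (⁅x⁆⊆ x∈F) z∈F) w∈F)

  -- The pivot of a member without forcing points itself forces nothing, so `pivots-unforced` is
  -- summed over at most `n` points.
  members-unforced : AvoidsTrace 1 𝓕 →
    length (filter (¬? ∘ meetsForced?) (members 𝓕)) ≤ n * ((3 + e) * ((3 + e) * n ^ e))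
  members-unforced avoids = begin
    length (filter (¬? ∘ meetsForced?) (members 𝓕))
      ≤⟨ unique-⊆⇒length≤ (filter⁺ (¬? ∘ meetsForced?) (unique 𝓕)) covered ⟩
    length (concatMap cover (elements U))
      ≤⟨ length-concatMap-≤ cover (elements U) (λ {x} x∈ → pivots-unforced x (∈⟦⟧⁻ (¬? ∘ forced?) (∈-elements⁻ x∈))) ⟩
    length (elements U) * ((3 + e) * ((3 + e) * n ^ e))
      ≤⟨ *-monoˡ-≤ _ (≤-trans (≤-reflexive (length-elements U)) (∣p∣≤n U)) ⟩
    n * ((3 + e) * ((3 + e) * n ^ e)) ∎
    where
    open ≤-Reasoning
    U : Subset n
    U = ⟦ ¬? ∘ forced? ⟧
    cover : Fin n → List (Subset n)
    cover x = filter (pivot? x) (members 𝓕)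
    covered : filter (¬? ∘ meetsForced?) (members 𝓕) ⊆ˡ concatMap cover (elements U)
    covered {F} F∈ with ∈-filter⁻ (¬? ∘ meetsForced?) {xs = members 𝓕} F∈
    ... | F∈𝓕 , ¬meets with pivot-exists avoids F∈𝓕
    ... | x , pivot = ∈-concatMap-intro cover
      (∈-elements⁺ (∈⟦⟧⁺ (¬? ∘ forced?) λ forced → ¬meets (x , proj₁ pivot , forced)))
      (∈-filter⁺ (pivot? x) F∈𝓕 pivot)

-- The injection into d-sets

module _ {n d : ℕ} (𝓕 : UniformFamily n (suc d)) where
  open Traces 𝓕

  -- All forcing pairs are excluded, so the property does not depend on which pair the injection
  -- selects for `F`.
  Unreached : Subset n → Set
  Unreached D = ∀ {F x y} → F ∈ᶠ 𝓕 → Forces x y → x ∈ₛ F → D ≢ F - y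

  -- F ↦ F - y, for some x ∈ F forcing y, is injective: the only way to extend
  -- the image to a set satisfying the forcing relations is to add y.
  members-forced : (Ds : List (Subset n)) → Unique Ds → (∀ {D} → D ∈ Ds → ∣ D ∣ ≡ d × Unreached D) →
    length (filter meetsForced? (members 𝓕)) + length Ds ≤ n C d
  members-forced Ds !Ds Ds-unreached
    with unique-image (λ F D → ∃₂ λ x y → Forces x y × x ∈ₛ F × D ≡ F - y)
           (filter⁺ meetsForced? (unique 𝓕)) total injective
    where
    total : ∀ {F} → F ∈ filter meetsForced? (members 𝓕) →
      ∃[ D ] ∃₂ λ x y → Forces x y × x ∈ₛ F × D ≡ F - y
    total {F} F∈ with ∈-filter⁻ meetsForced? {xs = members 𝓕} F∈
    ... | _ , x , x∈F , y , x→y = F - y , x , y , x→y , x∈F , refl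
    injective : ∀ {F F′ D} → F ∈ filter meetsForced? (members 𝓕) → F′ ∈ filter meetsForced? (members 𝓕) →
      (∃₂ λ x y → Forces x y × x ∈ₛ F × D ≡ F - y) → (∃₂ λ x y → Forces x y × x ∈ₛ F′ × D ≡ F′ - y) → F ≡ F′
    injective {F} {F′} F∈ F′∈ (x , y , (y≢x , x→y) , x∈F , refl) (x′ , y′ , (_ , x′→y′) , x′∈F′ , eq) =
      begin
        F                     ≡⟨ [p-x]∪⁅x⁆≡p (All.lookup x→y F∈𝓕 x∈F) ⟨
        (F - y) ∪ ⁅ y ⁆       ≡⟨ cong₂ (λ D z → D ∪ ⁅ z ⁆) eq y≡y′ ⟩
        (F′ - y′) ∪ ⁅ y′ ⁆    ≡⟨ [p-x]∪⁅x⁆≡p (All.lookup x′→y′ F′∈𝓕 x′∈F′) ⟩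
        F′                    ∎
      where
      open ≡-Reasoning
      F∈𝓕 = proj₁ (∈-filter⁻ meetsForced? {xs = members 𝓕} F∈)
      F′∈𝓕 = proj₁ (∈-filter⁻ meetsForced? {xs = members 𝓕} F′∈)
      x∈F′ : x ∈ₛ F′
      x∈F′ = proj₁ (x∈p-y⁻ F′ y′ (subst (x ∈ₛ_) eq (x∈p∧x≢y⇒x∈p-y x∈F (y≢x ∘ sym))))
      -- As `x ∈ F′` forces `y`, also `y ∈ F′`. If `y ≢ y′`, then `y` survives in `F′ - y′`, which
      -- equals `F - y`.
      y≡y′ : y ≡ y′
      y≡y′ = decidable-stable (y ≟ y′) λ y≢y′ → proj₂ (x∈p-y⁻ F y
        (subst (y ∈ₛ_) (sym eq) (x∈p∧x≢y⇒x∈p-y (All.lookup x→y F′∈𝓕 x∈F′) y≢y′))) refl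
  ... | Es , !Es , ∣Es∣ , Es-images = begin
    length (filter meetsForced? (members 𝓕)) + length Ds  ≡⟨ cong (_+ length Ds) ∣Es∣ ⟨
    length Es + length Ds                                 ≡⟨ length-++ Es ⟨
    length (Es ++ Ds)                                     ≤⟨ unique-⊆⇒length≤ (++⁺ !Es !Ds disjoint) included ⟩
    length (subsetsOf (⊤ {n}) d)                             ≡⟨ length-subsetsOf (⊤ {n}) d ⟩
    ∣ ⊤ {n} ∣ C d                                         ≡⟨ cong (_C d) (∣⊤∣≡n n) ⟩
    n C d                                                 ∎
    where
    open ≤-Reasoning
    disjoint : ∀ {D} → ¬ (D ∈ Es × D ∈ Ds)
    disjoint (D∈Es , D∈Ds) with Es-images D∈Es
    ... | F , F∈ , x , y , x→y , x∈F , D≡F-y =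
      proj₂ (Ds-unreached D∈Ds) (proj₁ (∈-filter⁻ meetsForced? {xs = members 𝓕} F∈)) x→y x∈F D≡F-y
    size : ∀ {D} → D ∈ Es ++ Ds → ∣ D ∣ ≡ d
    size D∈ with ∈-++⁻ Es D∈
    ... | inj₂ D∈Ds = proj₁ (Ds-unreached D∈Ds)
    ... | inj₁ D∈Es with Es-images D∈Es
    ...   | F , F∈ , x , y , (_ , x→y) , x∈F , refl with ∈-filter⁻ meetsForced? {xs = members 𝓕} F∈
    ...     | F∈𝓕 , _ = cong (_∸ 1) (trans (sym (∣p∣≡1+∣p-x∣ (All.lookup x→y F∈𝓕 x∈F))) (uniform 𝓕 F∈𝓕))
    included : Es ++ Ds ⊆ˡ subsetsOf ⊤ d
    included {D} D∈ = subst (λ j → D ∈ subsetsOf ⊤ j) (size D∈) (∈-subsetsOf⁺ ⊆⊤)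

-- Members avoiding and members containing a fixed point y

module _ {n j : ℕ} (𝓕 : UniformFamily n (2 + j)) (y : Fin n) where
  open Traces 𝓕

  -- The points other than `y` split into these and the points of `forcing`; a member avoiding `y`
  -- consists of these alone.
  NotForcing : Fin n → Set
  NotForcing x = x ≢ y × ¬ Forces x y

  notForcing? : ∀ x → Dec (NotForcing x)
  notForcing? x = ¬? (x ≟ y) ×-dec ¬? (forces? x y)

  PivotAvoiding : Fin n → Subset n → Set
  PivotAvoiding x F = y ∉ₛ F × Pivot x F

  pivotAvoiding? : ∀ x F → Dec (PivotAvoiding x F)
  pivotAvoiding? x F = ¬? (y ∈? F) ×-dec pivot? x F

  -- The length of this list is the common factor in the bounds on the members avoiding `y` and on
  -- the sets they exclude, so gain and loss can be compared per pivot.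
  pivotsAvoiding : List (Fin n)
  pivotsAvoiding = filter (λ x → Any.any? (pivotAvoiding? x) (members 𝓕)) (allFin n)

  avoiding⇒notForcing : F ∈ᶠ 𝓕 → y ∉ₛ F → x ∈ₛ F → NotForcing x
  avoiding⇒notForcing F∈𝓕 y∉F x∈F =
    (λ { refl → y∉F x∈F }) , λ { (_ , x→y) → y∉F (All.lookup x→y F∈𝓕 x∈F) }

  -- Any such member meets a fixed one, `F₀`, in some `z ≢ x`, with at most `2 + j` choices for `z`.
  -- Its other `j` points do not force `y`, since it avoids `y`.
  avoiding-with-pivot : ∀ x → length (filter (pivotAvoiding? x) (members 𝓕)) ≤ (2 + j) * ∣ ⟦ notForcing? ⟧ ∣ ^ j
  avoiding-with-pivot x = length≤-if-inhabited (filter (pivotAvoiding? x) (members 𝓕)) bound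
    where
    bound : ∀ {F₀} → F₀ ∈ filter (pivotAvoiding? x) (members 𝓕) →
      length (filter (pivotAvoiding? x) (members 𝓕)) ≤ (2 + j) * ∣ ⟦ notForcing? ⟧ ∣ ^ j
    bound {F₀} F₀∈ = begin
      length (filter (pivotAvoiding? x) (members 𝓕))
        ≤⟨ unique-⊆⇒length≤ (filter⁺ (pivotAvoiding? x) (unique 𝓕)) covered ⟩
      length (concatMap cover (elements F₀))
        ≤⟨ length-concatMap-≤ cover (elements F₀) (λ {z} _ → length-extensions (elements ⟦ notForcing? ⟧) (⁅ x ⁆ ∪ ⁅ z ⁆) j) ⟩
      length (elements F₀) * length (elements ⟦ notForcing? ⟧) ^ j
        ≡⟨ cong₂ (λ a b → a * b ^ j) (length-elements-member F₀∈𝓕) (length-elements ⟦ notForcing? ⟧) ⟩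
      (2 + j) * ∣ ⟦ notForcing? ⟧ ∣ ^ j ∎
      where
      open ≤-Reasoning
      F₀∈𝓕 = proj₁ (∈-filter⁻ (pivotAvoiding? x) {xs = members 𝓕} F₀∈)
      x∈F₀ = proj₁ (proj₂ (proj₂ (∈-filter⁻ (pivotAvoiding? x) {xs = members 𝓕} F₀∈)))
      cover : Fin n → List (Subset n)
      cover z = extensions (elements ⟦ notForcing? ⟧) (⁅ x ⁆ ∪ ⁅ z ⁆) j
      covered : filter (pivotAvoiding? x) (members 𝓕) ⊆ˡ concatMap cover (elements F₀)
      covered {F} F∈ with ∈-filter⁻ (pivotAvoiding? x) {xs = members 𝓕} F∈
      ... | F∈𝓕 , y∉F , x∈F , meets with All.lookup meets F₀∈𝓕 x∈F₀
      ... | z , z≢x , z∈F , z∈F₀ = ∈-concatMap-intro cover (∈-elements⁺ z∈F₀)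
        (∈-extensions j (p∪⁅x⁆⊆q (⁅x⁆⊆ x∈F) z∈F)
          (λ w∈F _ → ∈-elements⁺ (∈⟦⟧⁺ notForcing? (avoiding⇒notForcing F∈𝓕 y∉F w∈F)))
          (trans (uniform 𝓕 F∈𝓕) (trans (+-comm 2 j) (cong (j +_) (sym (∣pair∣ z≢x))))))

  members-avoiding : AvoidsTrace 1 𝓕 →
    length (filter (λ F → ¬? (y ∈? F)) (members 𝓕)) ≤ length pivotsAvoiding * ((2 + j) * ∣ ⟦ notForcing? ⟧ ∣ ^ j)
  members-avoiding avoids = ≤-trans
    (unique-⊆⇒length≤ (filter⁺ (λ F → ¬? (y ∈? F)) (unique 𝓕)) covered)
    (length-concatMap-≤ cover pivotsAvoiding λ {x} _ → avoiding-with-pivot x)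
    where
    cover : Fin n → List (Subset n)
    cover x = filter (pivotAvoiding? x) (members 𝓕)
    covered : filter (λ F → ¬? (y ∈? F)) (members 𝓕) ⊆ˡ concatMap cover pivotsAvoiding
    covered {F} F∈ with ∈-filter⁻ (λ F → ¬? (y ∈? F)) {xs = members 𝓕} F∈
    ... | F∈𝓕 , y∉F with pivot-exists avoids F∈𝓕
    ... | x , pivot = ∈-concatMap-intro cover
      (∈-filter⁺ (λ x → Any.any? (pivotAvoiding? x) (members 𝓕)) (∈-allFin x) (lose F∈𝓕 (y∉F , pivot)))
      (∈-filter⁺ (pivotAvoiding? x) F∈𝓕 (y∉F , pivot))

  forcing : Subset n
  forcing = ⟦ (λ x → forces? x y) ⟧

  ∈-pivotsAvoiding⁻ : x ∈ pivotsAvoiding → ∃[ F ] (F ∈ᶠ 𝓕 × PivotAvoiding x F)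
  ∈-pivotsAvoiding⁻ x∈ =
    find (proj₂ (∈-filter⁻ (λ x → Any.any? (pivotAvoiding? x) (members 𝓕)) {xs = allFin n} x∈))

  -- Such a point lies in a member avoiding `y`, where no point forces `y`. Hence in a set
  -- `E ∪ ⁅ x ⁆` with `E ⊆ forcing` the pivot `x` is the only point outside `forcing`, and the pair
  -- can be recovered.
  pivotsAvoiding∌forcing : x ∈ pivotsAvoiding → x ∉ₛ forcing
  pivotsAvoiding∌forcing x∈ x∈S with ∈-pivotsAvoiding⁻ x∈
  ... | F , F∈𝓕 , y∉F , x∈F , _ =
    proj₂ (avoiding⇒notForcing F∈𝓕 y∉F x∈F) (∈⟦⟧⁻ (λ x → forces? x y) x∈S)

  -- If x is the pivot of F₀ ∌ y, then no member is {y, x} ∪ E with all elements of E forcing y.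
  members-containing :
    length (filter (y ∈?_) (members 𝓕)) + length pivotsAvoiding * (∣ forcing ∣ C j) ≤ (n ∸ 1) C suc j
  members-containing
    -- With `y` removed, members containing `y` and excluded sets become `F - y` and `E ∪ ⁅ x ⁆`,
    -- two disjoint families of `suc j`-subsets of the complement of `y`.
    with unique-image (λ F D → y ∈ₛ F × D ≡ F - y) (filter⁺ (y ∈?_) (unique 𝓕)) total₁ injective₁
       | unique-image (λ xE D → D ≡ proj₂ xE ∪ ⁅ proj₁ xE ⁆)
           (dependentPairs-unique (λ _ → subsetsOf forcing j)
             (filter⁺ (λ x → Any.any? (pivotAvoiding? x) (members 𝓕)) (allFin⁺ n)) (λ _ → subsetsOf-unique forcing j))
           (λ _ → _ , refl) injective₂
    where
    total₁ : ∀ {F} → F ∈ filter (y ∈?_) (members 𝓕) → ∃[ D ] (y ∈ₛ F × D ≡ F - y)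
    total₁ F∈ = _ , proj₂ (∈-filter⁻ (y ∈?_) {xs = members 𝓕} F∈) , refl
    injective₁ : ∀ {F F′ D} → F ∈ filter (y ∈?_) (members 𝓕) → F′ ∈ filter (y ∈?_) (members 𝓕) →
      y ∈ₛ F × D ≡ F - y → y ∈ₛ F′ × D ≡ F′ - y → F ≡ F′
    injective₁ _ _ (y∈F , refl) (y∈F′ , eq) =
      trans (sym ([p-x]∪⁅x⁆≡p y∈F)) (trans (cong (_∪ ⁅ y ⁆) eq) ([p-x]∪⁅x⁆≡p y∈F′))
    injective₂ : ∀ {xE xE′ D} →
      xE ∈ dependentPairs (λ _ → subsetsOf forcing j) pivotsAvoiding →
      xE′ ∈ dependentPairs (λ _ → subsetsOf forcing j) pivotsAvoiding →
      D ≡ proj₂ xE ∪ ⁅ proj₁ xE ⁆ → D ≡ proj₂ xE′ ∪ ⁅ proj₁ xE′ ⁆ → xE ≡ xE′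
    injective₂ {x , E} {x′ , E′} xE∈ xE′∈ refl eq
      with ∈-dependentPairs⁻ (λ _ → subsetsOf forcing j) pivotsAvoiding xE∈ | ∈-dependentPairs⁻ (λ _ → subsetsOf forcing j) pivotsAvoiding xE′∈
    ... | x∈ , E∈ | x′∈ , E′∈
      with ∈-subsetsOf⁻ forcing j E∈ | ∈-subsetsOf⁻ forcing j E′∈ | x∈p∪⁅y⁆⁻ (subst (x ∈ₛ_) eq (y∈p∪⁅y⁆ {p = E}))
    ... | _        | E′⊆S , _ | inj₁ x∈E′ = contradiction (E′⊆S x∈E′) (pivotsAvoiding∌forcing x∈)
    ... | E⊆S , _  | E′⊆S , _ | inj₂ refl = cong (x ,_) (begin
      E                  ≡⟨ [p∪⁅x⁆]-x≡p (pivotsAvoiding∌forcing x∈ ∘ E⊆S) ⟨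
      (E ∪ ⁅ x ⁆) - x    ≡⟨ cong (_- x) eq ⟩
      (E′ ∪ ⁅ x ⁆) - x   ≡⟨ [p∪⁅x⁆]-x≡p (pivotsAvoiding∌forcing x∈ ∘ E′⊆S) ⟩
      E′                 ∎)
      where open ≡-Reasoning
  ... | Es , !Es , ∣Es∣ , Es-images | Ms , !Ms , ∣Ms∣ , Ms-images = begin
    length (filter (y ∈?_) (members 𝓕)) + length pivotsAvoiding * (∣ forcing ∣ C j)
      ≤⟨ +-monoʳ-≤ (length (filter (y ∈?_) (members 𝓕))) (length-dependentPairs (λ _ → subsetsOf forcing j) pivotsAvoiding
           (λ _ → ≤-reflexive (sym (length-subsetsOf forcing j)))) ⟩
    length (filter (y ∈?_) (members 𝓕)) + length (dependentPairs (λ _ → subsetsOf forcing j) pivotsAvoiding)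
      ≡⟨ cong₂ _+_ ∣Es∣ ∣Ms∣ ⟨
    length Es + length Ms            ≡⟨ length-++ Es ⟨
    length (Es ++ Ms)                ≤⟨ unique-⊆⇒length≤ (++⁺ !Es !Ms disjoint) included ⟩
    length (subsetsOf (∁ ⁅ y ⁆) (suc j))  ≡⟨ length-subsetsOf (∁ ⁅ y ⁆) (suc j) ⟩
    ∣ ∁ ⁅ y ⁆ ∣ C suc j              ≡⟨ cong (_C suc j) (trans (∣∁p∣≡n∸∣p∣ ⁅ y ⁆) (cong (n ∸_) (∣⁅x⁆∣≡1 y))) ⟩
    (n ∸ 1) C suc j                  ∎
    where
    open ≤-Reasoning
    -- A member `F` equal to `{y, x} ∪ E` would meet `F₀` in some `z ≢ x`. As `y ∉ F₀`, this `z`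
    -- lies in `E` and forces `y`, which no point of `F₀` does.
    disjoint : ∀ {D} → ¬ (D ∈ Es × D ∈ Ms)
    disjoint (D∈Es , D∈Ms) with Es-images D∈Es | Ms-images D∈Ms
    ... | F , F∈ , y∈F , refl | (x , E) , xE∈ , F-y≡E∪x
      with ∈-filter⁻ (y ∈?_) {xs = members 𝓕} F∈ | ∈-dependentPairs⁻ (λ _ → subsetsOf forcing j) pivotsAvoiding xE∈
    ... | F∈𝓕 , _ | x∈ , E∈ with ∈-pivotsAvoiding⁻ x∈
    ... | F₀ , F₀∈𝓕 , y∉F₀ , x∈F₀ , meets
      with All.lookup meets F∈𝓕 (proj₁ (x∈p-y⁻ F y (subst (x ∈ₛ_) (sym F-y≡E∪x) (y∈p∪⁅y⁆ {p = E}))))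
    ... | z , z≢x , z∈F₀ , z∈F
      with x∈p∪⁅y⁆⁻ (subst (z ∈ₛ_) F-y≡E∪x (x∈p∧x≢y⇒x∈p-y z∈F λ { refl → y∉F₀ z∈F₀ }))
    ... | inj₂ z≡x = z≢x z≡x
    ... | inj₁ z∈E = proj₂ (avoiding⇒notForcing F₀∈𝓕 y∉F₀ z∈F₀)
      (∈⟦⟧⁻ (λ x → forces? x y) (proj₁ (∈-subsetsOf⁻ forcing j E∈) z∈E))
    size : ∀ {D} → D ∈ Es ++ Ms → D ⊆ ∁ ⁅ y ⁆ × ∣ D ∣ ≡ suc j
    size D∈ with ∈-++⁻ Es D∈
    size D∈ | inj₁ D∈Es with Es-images D∈Es
    ... | F , F∈ , y∈F , refl =
      (λ z∈ → x∉p⇒x∈∁p (x≢y⇒x∉⁅y⁆ (proj₂ (x∈p-y⁻ F y z∈)))) ,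
      cong (_∸ 1) (trans (sym (∣p∣≡1+∣p-x∣ y∈F)) (uniform 𝓕 (proj₁ (∈-filter⁻ (y ∈?_) {xs = members 𝓕} F∈))))
    size D∈ | inj₂ D∈Ms with Ms-images D∈Ms
    ... | (x , E) , xE∈ , refl with ∈-dependentPairs⁻ (λ _ → subsetsOf forcing j) pivotsAvoiding xE∈
    ... | x∈ , E∈ with ∈-subsetsOf⁻ forcing j E∈ | ∈-pivotsAvoiding⁻ x∈
    ... | E⊆S , ∣E∣≡j | F₀ , _ , y∉F₀ , x∈F₀ , _ =
      p∪⁅x⁆⊆q
        (λ z∈E → x∉p⇒x∈∁p (x≢y⇒x∉⁅y⁆ λ { refl → proj₁ (∈⟦⟧⁻ (λ x → forces? x y) (E⊆S z∈E)) refl }))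
        (x∉p⇒x∈∁p (x≢y⇒x∉⁅y⁆ λ { refl → y∉F₀ x∈F₀ })) ,
      trans (∣p∪⁅x⁆∣ (pivotsAvoiding∌forcing x∈ ∘ E⊆S)) (cong suc ∣E∣≡j)
    included : Es ++ Ms ⊆ˡ subsetsOf (∁ ⁅ y ⁆) (suc j)
    included {D} D∈ with size D∈
    ... | D⊆ , ∣D∣ = subst (λ i → D ∈ subsetsOf (∁ ⁅ y ⁆) i) ∣D∣ (∈-subsetsOf⁺ D⊆)

-- The d-sets missed by the injection

-- A set D is unreached if it consists of elements forcing nothing, or if it
-- contains x₁ and x₂ forcing y₁ ∉ D and y₂ ∉ D such that x₂ does not force y₁.
module ManyUnreached {n e : ℕ} (𝓕 : UniformFamily n (3 + e)) where
  open Traces 𝓕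

  d : ℕ
  d = 2 + e

  unforced : Subset n
  unforced = ⟦ ¬? ∘ forced? ⟧

  -- For a point forcing nothing the value is a default; configurations only involve targets of
  -- points that force something.
  target : Fin n → Fin n
  target x with forced? x
  ... | yes (y , _) = y
  ... | no _        = x

  forces-target : Forced x → Forces x (target x)
  forces-target {x} forced with forced? x
  ... | yes (_ , x→y) = x→y
  ... | no ¬forced    = contradiction forced ¬forced

  -- With `y = target x₁`, these are the candidates for `x₂`.
  ForcedElsewhere : Fin n → Fin n → Set
  ForcedElsewhere y x = NotForcing 𝓕 y x × Forced x

  forcedElsewhere? : ∀ y x → Dec (ForcedElsewhere y x)
  forcedElsewhere? y x = notForcing? 𝓕 y x ×-dec forced? x

  -- `E` has to avoid `x₁` and `x₂` for the union to have `d` elements, and both targets for them to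
  -- stay outside the union.
  occupied : Fin n → Fin n → Subset n
  occupied x₁ x₂ = ((⁅ x₁ ⁆ ∪ ⁅ x₂ ⁆) ∪ ⁅ target x₁ ⁆) ∪ ⁅ target x₂ ⁆

  ∣occupied∣≤4 : ∀ x₁ x₂ → ∣ occupied x₁ x₂ ∣ ≤ 4
  ∣occupied∣≤4 x₁ x₂ =
    ≤-trans (∣p∪⁅x⁆∣≤ ((⁅ x₁ ⁆ ∪ ⁅ x₂ ⁆) ∪ ⁅ target x₁ ⁆) (target x₂)) (s≤s
    (≤-trans (∣p∪⁅x⁆∣≤ (⁅ x₁ ⁆ ∪ ⁅ x₂ ⁆) (target x₁)) (s≤s
    (≤-trans (∣p∪⁅x⁆∣≤ ⁅ x₁ ⁆ x₂) (s≤s (≤-reflexive (∣⁅x⁆∣≡1 x₁)))))))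

  fillings : Fin n → Fin n → List (Subset n)
  fillings x₁ x₂ = subsetsOf (∁ (occupied x₁ x₂)) e

  configurationsFrom : Fin n → List (Fin n × Subset n)
  configurationsFrom x₁ = dependentPairs (fillings x₁) (elements ⟦ forcedElsewhere? (target x₁) ⟧)

  -- Each D in the image of union arises from at most d² configurations, one
  -- for each choice of x₁ and x₂ in D.
  configurations : List (Fin n × Fin n × Subset n)
  configurations = dependentPairs configurationsFrom (elements (∁ unforced))

  configurations-unique : Unique configurations
  configurations-unique = dependentPairs-unique configurationsFrom (elements-unique (∁ unforced)) λ {x₁} _ →
    dependentPairs-unique (fillings x₁) (elements-unique ⟦ forcedElsewhere? (target x₁) ⟧) λ {x₂} _ →
    subsetsOf-unique (∁ (occupied x₁ x₂)) e

  record Configuration (x₁ x₂ : Fin n) (E : Subset n) : Set where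
    field
      x₁→y₁  : Forces x₁ (target x₁)
      x₂→y₂  : Forces x₂ (target x₂)
      x₂↛y₁  : NotForcing 𝓕 (target x₁) x₂
      E⊆     : E ⊆ ∁ (occupied x₁ x₂)
      ∣E∣    : ∣ E ∣ ≡ e

  ∈-configurations⁻ : ∀ {x₁ x₂ E} → (x₁ , x₂ , E) ∈ configurations → Configuration x₁ x₂ E
  ∈-configurations⁻ {x₁} {x₂} {E} c∈ with ∈-dependentPairs⁻ configurationsFrom (elements (∁ unforced)) c∈
  ... | x₁∈ , c∈′ with ∈-dependentPairs⁻ (fillings x₁) (elements ⟦ forcedElsewhere? (target x₁) ⟧) c∈′
  ... | x₂∈ , E∈ with ∈⟦⟧⁻ (forcedElsewhere? (target x₁)) (∈-elements⁻ x₂∈) | ∈-subsetsOf⁻ (∁ (occupied x₁ x₂)) e E∈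
  ... | x₂↛y₁ , forced₂ | E⊆ , ∣E∣ = record
    { x₁→y₁ = forces-target (decidable-stable (forced? x₁) λ ¬forced →
        x∈∁p⇒x∉p (∈-elements⁻ x₁∈) (∈⟦⟧⁺ (¬? ∘ forced?) ¬forced))
    ; x₂→y₂ = forces-target forced₂
    ; x₂↛y₁ = x₂↛y₁
    ; E⊆    = E⊆
    ; ∣E∣   = ∣E∣
    }

  union : Fin n × Fin n × Subset n → Subset n
  union (x₁ , x₂ , E) = (E ∪ ⁅ x₂ ⁆) ∪ ⁅ x₁ ⁆

  module _ {x₁ x₂ E} (c : Configuration x₁ x₂ E) where
    open Configuration c

    occupied∌ : x ∈ₛ E → x ∉ₛ occupied x₁ x₂
    occupied∌ = x∈∁p⇒x∉p ∘ E⊆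

    x₁∉E : x₁ ∉ₛ E
    x₁∉E x₁∈E = occupied∌ x₁∈E (x∈p∪q⁺ (inj₁ (x∈p∪q⁺ (inj₁ (x∈p∪q⁺ (inj₁ (x∈⁅x⁆ x₁)))))))

    x₂∉E : x₂ ∉ₛ E
    x₂∉E x₂∈E = occupied∌ x₂∈E (x∈p∪q⁺ (inj₁ (x∈p∪q⁺ (inj₁ y∈p∪⁅y⁆))))

    y₁∉E : target x₁ ∉ₛ E
    y₁∉E y₁∈E = occupied∌ y₁∈E (x∈p∪q⁺ (inj₁ (y∈p∪⁅y⁆ {p = ⁅ x₁ ⁆ ∪ ⁅ x₂ ⁆})))

    y₂∉E : target x₂ ∉ₛ E
    y₂∉E y₂∈E = occupied∌ y₂∈E (y∈p∪⁅y⁆ {p = (⁅ x₁ ⁆ ∪ ⁅ x₂ ⁆) ∪ ⁅ target x₁ ⁆})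

    x₁≢x₂ : x₁ ≢ x₂
    x₁≢x₂ refl = proj₂ x₂↛y₁ x₁→y₁

    x₁∉E∪x₂ : x₁ ∉ₛ E ∪ ⁅ x₂ ⁆
    x₁∉E∪x₂ = [ x₁∉E , x₁≢x₂ ]′ ∘ x∈p∪⁅y⁆⁻

    ∉-union : x ∉ₛ E → x ≢ x₂ → x ≢ x₁ → x ∉ₛ union (x₁ , x₂ , E)
    ∉-union x∉E x≢x₂ x≢x₁ = [ [ x∉E , x≢x₂ ]′ ∘ x∈p∪⁅y⁆⁻ , x≢x₁ ]′ ∘ x∈p∪⁅y⁆⁻

    x₁∈union : x₁ ∈ₛ union (x₁ , x₂ , E)
    x₁∈union = y∈p∪⁅y⁆ {p = E ∪ ⁅ x₂ ⁆}

    x₂∈union : x₂ ∈ₛ union (x₁ , x₂ , E)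
    x₂∈union = x∈p∪q⁺ (inj₁ (y∈p∪⁅y⁆ {p = E}))

    y₁∉union : target x₁ ∉ₛ union (x₁ , x₂ , E)
    y₁∉union = ∉-union y₁∉E (proj₁ x₂↛y₁ ∘ sym) (proj₁ x₁→y₁)

    y₂∉union : target x₂ ∉ₛ union (x₁ , x₂ , E)
    -- If `y₂` were `x₁`, then `x₂` would force `x₁` and, by transitivity, `y₁`.
    y₂∉union = ∉-union y₂∉E (proj₁ x₂→y₂) λ y₂≡x₁ →
      proj₂ x₂↛y₁ (forces-trans (subst (Forces x₂) y₂≡x₁ x₂→y₂) x₁→y₁ (proj₁ x₂↛y₁ ∘ sym))

    ∣union∣ : ∣ union (x₁ , x₂ , E) ∣ ≡ d
    ∣union∣ = trans (∣p∪⁅x⁆∣ x₁∉E∪x₂) (cong suc (trans (∣p∪⁅x⁆∣ x₂∉E) (cong suc ∣E∣)))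

    -- If the union were `F - y`, then `F` would contain `x₁` and `x₂`, hence both targets. Neither
    -- target is in the union, so both equal `y`, and `x₂` would force `y₁`.
    union-unreached : Unreached 𝓕 (union (x₁ , x₂ , E))
    union-unreached {F} {x} {y} F∈𝓕 x→y x∈F D≡F-y =
      proj₂ x₂↛y₁ (subst (Forces x₂) (trans (added x₂→y₂ x₂∈union y₂∉union) (sym (added x₁→y₁ x₁∈union y₁∉union))) x₂→y₂)
      where
      added : ∀ {z w} → Forces z w → z ∈ₛ union (x₁ , x₂ , E) → w ∉ₛ union (x₁ , x₂ , E) → w ≡ y
      added {z} {w} (_ , z→w) z∈D w∉D = decidable-stable (w ≟ y) λ w≢y → w∉D (subst (w ∈ₛ_) (sym D≡F-y)
        (x∈p∧x≢y⇒x∈p-y (All.lookup z→w F∈𝓕 (proj₁ (x∈p-y⁻ F y (subst (z ∈ₛ_) D≡F-y z∈D)))) w≢y))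

    union-minus : (union (x₁ , x₂ , E) - x₁) - x₂ ≡ E
    union-minus = trans (cong (_- x₂) ([p∪⁅x⁆]-x≡p x₁∉E∪x₂)) ([p∪⁅x⁆]-x≡p x₂∉E)

  unions : List (Subset n)
  unions = deduplicate (≡-dec _≟ᵇ_) (map union configurations)

  unions-unreached : ∀ {D} → D ∈ unions → ∣ D ∣ ≡ d × Unreached 𝓕 D
  unions-unreached D∈ with ∈-map⁻ union (∈-deduplicate⁻ (≡-dec _≟ᵇ_) (map union configurations) D∈)
  ... | (x₁ , x₂ , E) , c∈ , refl = ∣union∣ (∈-configurations⁻ c∈) , union-unreached (∈-configurations⁻ c∈)

  ∣configurations∣≤ : length configurations ≤ length unions * (d * d)
  ∣configurations∣≤ = ≤-trans
    (unique-⊆⇒length≤ configurations-unique covered)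
    (length-concatMap-≤ decompositions unions λ {D} D∈ →
      ≤-trans (length-concatMap-≤ (decompositionsFrom D) (elements D)
                 (λ {x₁} _ → ≤-reflexive (length-map (λ x₂ → x₁ , x₂ , (D - x₁) - x₂) (elements D))))
              (≤-reflexive (cong₂ _*_ (∣elements∣ D∈) (∣elements∣ D∈))))
    where
    ∣elements∣ : ∀ {D} → D ∈ unions → length (elements D) ≡ d
    ∣elements∣ {D} D∈ = trans (length-elements D) (proj₁ (unions-unreached D∈))
    decompositionsFrom : Subset n → Fin n → List (Fin n × Fin n × Subset n)
    decompositionsFrom D x₁ = map (λ x₂ → x₁ , x₂ , (D - x₁) - x₂) (elements D)
    decompositions : Subset n → List (Fin n × Fin n × Subset n)
    decompositions D = concatMap (decompositionsFrom D) (elements D)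
    covered : configurations ⊆ˡ concatMap decompositions unions
    covered {x₁ , x₂ , E} c∈ = ∈-concatMap-intro decompositions
      (∈-deduplicate⁺ (≡-dec _≟ᵇ_) (∈-map⁺ union c∈))
      (∈-concatMap-intro (decompositionsFrom (union (x₁ , x₂ , E))) (∈-elements⁺ (x₁∈union c))
        (subst (λ E′ → (x₁ , x₂ , E′) ∈ decompositionsFrom (union (x₁ , x₂ , E)) x₁) (union-minus c)
          (∈-map⁺ _ (∈-elements⁺ (x₂∈union c)))))
      where c = ∈-configurations⁻ c∈

  -- `v` will be roughly a fixed proportion of `n`. In `spread`, one summand `d * v` allows for
  -- points that force nothing and the other leaves choices for `x₂`.
  module _ (v : ℕ) (room : (4 + e) * v ≤ n) (v≥1 : 1 ≤ v)
           (spread : ∀ y → d * v + d * v ≤ ∣ ⟦ notForcing? 𝓕 y ⟧ ∣) where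

    v≤dv : v ≤ d * v
    v≤dv = m≤m+n v ((1 + e) * v)

    -- There are at least `v` choices for `x₁`, then `v` for `x₂`, then `v ^ e` for `E`.
    configurations-many : ∣ unforced ∣ < d * v → v ^ d ≤ length configurations
    configurations-many few = begin
      v * (v * v ^ e)
        ≤⟨ *-monoˡ-≤ (v * v ^ e) v≤∣∁unforced∣ ⟩
      length (elements (∁ unforced)) * (v * v ^ e)
        ≤⟨ length-dependentPairs configurationsFrom (elements (∁ unforced)) (λ {x₁} _ → from x₁) ⟩
      length configurations ∎
      where
      open ≤-Reasoning
      v≤∣∁unforced∣ : v ≤ length (elements (∁ unforced))
      v≤∣∁unforced∣ = begin
        v                               ≡⟨ m+n∸n≡m v (d * v) ⟨
        (v + d * v) ∸ d * v             ≤⟨ ∸-mono (≤-trans (*-monoˡ-≤ v (n≤1+n (3 + e))) room) (<⇒≤ few) ⟩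
        n ∸ ∣ unforced ∣                ≡⟨ ∣∁p∣≡n∸∣p∣ unforced ⟨
        ∣ ∁ unforced ∣                  ≡⟨ length-elements (∁ unforced) ⟨
        length (elements (∁ unforced))  ∎
      v≤∣forcedElsewhere∣ : ∀ y → v ≤ length (elements ⟦ forcedElsewhere? y ⟧)
      v≤∣forcedElsewhere∣ y = ≤-trans v≤dv (+-cancelʳ-≤ (d * v) (d * v) _ (begin
        d * v + d * v                                              ≤⟨ spread y ⟩
        ∣ ⟦ notForcing? 𝓕 y ⟧ ∣                                    ≤⟨ p⊆q⇒∣p∣≤∣q∣ split ⟩
        ∣ ⟦ forcedElsewhere? y ⟧ ∪ unforced ∣                      ≤⟨ ∣p∪q∣≤∣p∣+∣q∣ ⟦ forcedElsewhere? y ⟧ unforced ⟩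
        ∣ ⟦ forcedElsewhere? y ⟧ ∣ + ∣ unforced ∣                  ≤⟨ +-mono-≤ (≤-reflexive (sym (length-elements ⟦ forcedElsewhere? y ⟧))) (<⇒≤ few) ⟩
        length (elements ⟦ forcedElsewhere? y ⟧) + d * v           ∎))
        where
        split : ⟦ notForcing? 𝓕 y ⟧ ⊆ ⟦ forcedElsewhere? y ⟧ ∪ unforced
        split {x} x∈ with forced? x
        ... | yes forced = x∈p∪q⁺ (inj₁ (∈⟦⟧⁺ (forcedElsewhere? y) (∈⟦⟧⁻ (notForcing? 𝓕 y) x∈ , forced)))
        ... | no ¬forced = x∈p∪q⁺ (inj₂ (∈⟦⟧⁺ (¬? ∘ forced?) ¬forced))
      filling : ∀ x₁ x₂ → v ^ e ≤ length (fillings x₁ x₂)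
      filling x₁ x₂ = begin
        v ^ e                             ≤⟨ t^k≤mCk v e ev≤ ⟩
        ∣ ∁ (occupied x₁ x₂) ∣ C e        ≡⟨ length-subsetsOf (∁ (occupied x₁ x₂)) e ⟨
        length (fillings x₁ x₂)           ∎
        where
        -- At most four points are removed, which is at most `4 * v` as `v ≥ 1`; this is the 4 in
        -- `room`.
        ev≤ : e * v ≤ ∣ ∁ (occupied x₁ x₂) ∣
        ev≤ = begin
          e * v                           ≡⟨ m+n∸m≡n (4 * v) (e * v) ⟨
          (4 * v + e * v) ∸ 4 * v         ≡⟨ cong (_∸ 4 * v) (*-distribʳ-+ v 4 e) ⟨
          (4 + e) * v ∸ 4 * v             ≤⟨ ∸-mono room (≤-trans (∣occupied∣≤4 x₁ x₂) (*-monoʳ-≤ 4 v≥1)) ⟩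
          n ∸ ∣ occupied x₁ x₂ ∣          ≡⟨ ∣∁p∣≡n∸∣p∣ (occupied x₁ x₂) ⟨
          ∣ ∁ (occupied x₁ x₂) ∣          ∎
      from : ∀ x₁ → v * v ^ e ≤ length (configurationsFrom x₁)
      from x₁ = begin
        v * v ^ e
          ≤⟨ *-monoˡ-≤ (v ^ e) (v≤∣forcedElsewhere∣ (target x₁)) ⟩
        length (elements ⟦ forcedElsewhere? (target x₁) ⟧) * v ^ e
          ≤⟨ length-dependentPairs (fillings x₁) (elements ⟦ forcedElsewhere? (target x₁) ⟧) (λ {x₂} _ → filling x₁ x₂) ⟩
        length (configurationsFrom x₁) ∎

    -- If at least `d * v` points force nothing, the d-sets of such points serve, because `F - y`
    -- always retains a point that forces `y`. Otherwise enough forcing points remain for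
    -- configurations, and the factor `d * d` is their multiplicity.
    many-unreached : ∃[ Ds ] (Unique Ds × (∀ {D} → D ∈ Ds → ∣ D ∣ ≡ d × Unreached 𝓕 D) × v ^ d ≤ length Ds * (d * d))
    many-unreached with d * v ≤? ∣ unforced ∣
    ... | no few  = unions , DecUnique.deduplicate-! (≡-dec _≟ᵇ_) (map union configurations) , unions-unreached ,
      ≤-trans (configurations-many (≰⇒> few)) ∣configurations∣≤
    ... | yes many = subsetsOf unforced d , subsetsOf-unique unforced d , unreached , (begin
      v ^ d                                     ≤⟨ t^k≤mCk v d many ⟩
      ∣ unforced ∣ C d                          ≡⟨ length-subsetsOf unforced d ⟨
      length (subsetsOf unforced d)             ≤⟨ m≤m*n _ (d * d) ⟩
      length (subsetsOf unforced d) * (d * d)   ∎)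
      where
      open ≤-Reasoning
      unreached : ∀ {D} → D ∈ subsetsOf unforced d → ∣ D ∣ ≡ d × Unreached 𝓕 D
      unreached D∈ with ∈-subsetsOf⁻ unforced d D∈
      ... | D⊆ , ∣D∣ = ∣D∣ , λ { F∈𝓕 (y≢x , x→y) x∈F refl →
        ∈⟦⟧⁻ (¬? ∘ forced?) (D⊆ (x∈p∧x≢y⇒x∈p-y x∈F (y≢x ∘ sym))) (_ , y≢x , x→y) }

-- Numerical estimates

^-distribʳ-* : ∀ k m n → (m * n) ^ k ≡ m ^ k * n ^ k
^-distribʳ-* zero    m n = refl
^-distribʳ-* (suc k) m n = trans (cong (m * n *_) (^-distribʳ-* k m n)) ([m*n]*[o*p]≡[m*o]*[n*p] m n (m ^ k) (n ^ k))

regroup-concentrated : ∀ c r k w → (c + r * (k * w)) + r * w ≡ c + r * (suc k * w)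
regroup-concentrated =
  solve 4 (λ c r k w → (c :+ r :* (k :* w)) :+ r :* w := c :+ r :* (w :+ k :* w)) refl
  where open +-*-Solver using (solve; con; _:+_; _:*_; _:=_)

regroup-spread : ∀ f n k w → ((f + n * (k * (k * w))) + n * w) + n * w ≡ f + (k * k + 2) * (n * w)
regroup-spread =
  solve 4 (λ f n k w → ((f :+ n :* (k :* (k :* w))) :+ n :* w) :+ n :* w := f :+ (k :* k :+ con 2) :* (n :* w)) refl
  where open +-*-Solver using (solve; con; _:+_; _:*_; _:=_)

rotate-factors : ∀ a b c f → a * (b * c) * f ≡ f * (a * b) * c
rotate-factors = solve 4 (λ a b c f → a :* (b :* c) :* f := f :* (a :* b) :* c) refl
  where open +-*-Solver using (solve; con; _:+_; _:*_; _:=_)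

-- The deficit in the concentrated and in the spread case

module Deficit {n e : ℕ} (𝓕 : UniformFamily n (3 + e)) (avoids : AvoidsTrace 1 𝓕) where
  open Traces 𝓕

  d : ℕ
  d = 2 + e

  -- Each point of `pivotsAvoiding 𝓕 y` accounts for at most `(3 + e) * u ^ (1 + e)` members
  -- avoiding `y` and excludes at least `(4 + e) * u ^ (1 + e)` sets containing `y`, a net loss of
  -- `u ^ (1 + e)`. If there is no such point, `y` is the centre of a star.
  concentrated : ∀ y u → ∣ ⟦ notForcing? 𝓕 y ⟧ ∣ < u → (1 + (1 + e) * (4 + e)) * u ≤ n →
    (IsStar 𝓕 × card 𝓕 ≤ (n ∸ 1) C d) ⊎ card 𝓕 + u ^ (1 + e) ≤ (n ∸ 1) C d
  concentrated y u ∣R∣<u room =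
    by-number-of-pivots (length (pivotsAvoiding 𝓕 y)) (members-containing 𝓕 y) (members-avoiding 𝓕 y avoids)
    where
    open ≤-Reasoning
    containing = length (filter (y ∈?_) (members 𝓕))
    avoiding   = length (filter (λ F → ¬? (y ∈? F)) (members 𝓕))
    all⊆ : ⊤ ⊆ (forcing 𝓕 y ∪ ⟦ notForcing? 𝓕 y ⟧) ∪ ⁅ y ⁆
    all⊆ {x} _ with x ≟ y
    ... | yes refl = y∈p∪⁅y⁆ {p = forcing 𝓕 y ∪ ⟦ notForcing? 𝓕 y ⟧}
    ... | no x≢y with forces? x y
    ...   | yes x→y = x∈p∪q⁺ (inj₁ (x∈p∪q⁺ (inj₁ (∈⟦⟧⁺ (λ x → forces? x y) x→y))))
    ...   | no x↛y  = x∈p∪q⁺ (inj₁ (x∈p∪q⁺ (inj₂ (∈⟦⟧⁺ (notForcing? 𝓕 y) (x≢y , x↛y)))))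
    -- The strict inequality `∣R∣<u` makes up for the point `y` itself.
    n≤∣forcing∣+u : n ≤ ∣ forcing 𝓕 y ∣ + u
    n≤∣forcing∣+u = begin
      n                                                          ≡⟨ ∣⊤∣≡n n ⟨
      ∣ ⊤ {n} ∣                                                  ≤⟨ p⊆q⇒∣p∣≤∣q∣ all⊆ ⟩
      ∣ (forcing 𝓕 y ∪ ⟦ notForcing? 𝓕 y ⟧) ∪ ⁅ y ⁆ ∣            ≤⟨ ∣p∪⁅x⁆∣≤ (forcing 𝓕 y ∪ ⟦ notForcing? 𝓕 y ⟧) y ⟩
      suc ∣ forcing 𝓕 y ∪ ⟦ notForcing? 𝓕 y ⟧ ∣                  ≤⟨ s≤s (∣p∪q∣≤∣p∣+∣q∣ (forcing 𝓕 y) ⟦ notForcing? 𝓕 y ⟧) ⟩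
      suc (∣ forcing 𝓕 y ∣ + ∣ ⟦ notForcing? 𝓕 y ⟧ ∣)            ≡⟨ +-suc ∣ forcing 𝓕 y ∣ _ ⟨
      ∣ forcing 𝓕 y ∣ + suc ∣ ⟦ notForcing? 𝓕 y ⟧ ∣              ≤⟨ +-monoʳ-≤ ∣ forcing 𝓕 y ∣ ∣R∣<u ⟩
      ∣ forcing 𝓕 y ∣ + u                                        ∎
    -- This is the hypothesis of `t^k≤mCk` for `t = (4 + e) * u` and exponent `1 + e`.
    ∣forcing∣≥ : (1 + e) * ((4 + e) * u) ≤ ∣ forcing 𝓕 y ∣
    ∣forcing∣≥ = +-cancelˡ-≤ u _ _ (begin
      u + (1 + e) * ((4 + e) * u)    ≡⟨ cong (u +_) (*-assoc (1 + e) (4 + e) u) ⟨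
      (1 + (1 + e) * (4 + e)) * u    ≤⟨ room ⟩
      n                              ≤⟨ n≤∣forcing∣+u ⟩
      ∣ forcing 𝓕 y ∣ + u            ≡⟨ +-comm ∣ forcing 𝓕 y ∣ u ⟩
      u + ∣ forcing 𝓕 y ∣            ∎)
    many-forcing : (4 + e) * u ^ (1 + e) ≤ ∣ forcing 𝓕 y ∣ C (1 + e)
    many-forcing = begin
      (4 + e) * u ^ (1 + e)                ≤⟨ *-monoˡ-≤ (u ^ (1 + e)) (m≤m*n (4 + e) ((4 + e) ^ e) {{m^n≢0 (4 + e) e}}) ⟩
      (4 + e) ^ (1 + e) * u ^ (1 + e)      ≡⟨ ^-distribʳ-* (1 + e) (4 + e) u ⟨
      ((4 + e) * u) ^ (1 + e)              ≤⟨ t^k≤mCk ((4 + e) * u) (1 + e) ∣forcing∣≥ ⟩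
      ∣ forcing 𝓕 y ∣ C (1 + e)            ∎
    -- The number of pivots is abstracted to `r` so that it can be split into zero and successor.
    by-number-of-pivots : ∀ r →
      containing + r * (∣ forcing 𝓕 y ∣ C (1 + e)) ≤ (n ∸ 1) C d →
      avoiding ≤ r * ((3 + e) * ∣ ⟦ notForcing? 𝓕 y ⟧ ∣ ^ (1 + e)) →
      (IsStar 𝓕 × card 𝓕 ≤ (n ∸ 1) C d) ⊎ card 𝓕 + u ^ (1 + e) ≤ (n ∸ 1) C d
    -- Here `avoiding≤` reduces to `avoiding ≤ 0`, so every member contains `y`.
    by-number-of-pivots zero containing≤ avoiding≤ = inj₁ ((y , y∈) , (begin
      card 𝓕                 ≤⟨ length≤filter+filter¬ (y ∈?_) (unique 𝓕) ⟩
      containing + avoiding  ≤⟨ +-monoʳ-≤ containing avoiding≤ ⟩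
      containing + 0         ≤⟨ containing≤ ⟩
      (n ∸ 1) C d            ∎))
      where
      y∈ : ∀ F → F ∈ᶠ 𝓕 → y ∈ₛ F
      y∈ F F∈𝓕 = decidable-stable (y ∈? F) λ y∉F →
        <⇒≱ (∈-length (∈-filter⁺ (λ F → ¬? (y ∈? F)) F∈𝓕 y∉F)) avoiding≤
    by-number-of-pivots (suc r) containing≤ avoiding≤ = inj₂ (begin
      card 𝓕 + u ^ (1 + e)
        ≤⟨ +-monoˡ-≤ (u ^ (1 + e)) (length≤filter+filter¬ (y ∈?_) (unique 𝓕)) ⟩
      (containing + avoiding) + u ^ (1 + e)
        ≤⟨ +-mono-≤
             (+-monoʳ-≤ containing (≤-trans avoiding≤ (*-monoʳ-≤ (suc r) (*-monoʳ-≤ (3 + e) (^-monoˡ-≤ (1 + e) (<⇒≤ ∣R∣<u))))))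
             (m≤m+n (u ^ (1 + e)) (r * u ^ (1 + e))) ⟩
      (containing + suc r * ((3 + e) * u ^ (1 + e))) + suc r * u ^ (1 + e)
        ≡⟨ regroup-concentrated containing (suc r) (3 + e) (u ^ (1 + e)) ⟩
      containing + suc r * ((4 + e) * u ^ (1 + e))
        ≤⟨ +-monoʳ-≤ containing (*-monoʳ-≤ (suc r) many-forcing) ⟩
      containing + suc r * (∣ forcing 𝓕 y ∣ C (1 + e))
        ≤⟨ containing≤ ⟩
      (n ∸ 1) C d ∎)

  -- With `k = 3 + e` and `N = n ^ (1 + e)`, at least `(k * k + 2) * N` d-sets are missed. Of these,
  -- `k * k * N` outweigh the members without a forcing point, one `N` pays for passing from `n C d`
  -- to `(n ∸ 1) C d`, and one `N` remains as the deficit.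
  spread : ∀ v q → 1 ≤ v → (4 + e) * v ≤ n → n ^ (1 + e) ≤ q * v ^ (1 + e) →
    (d * d) * (((3 + e) * (3 + e) + 2) * q) ≤ v →
    (∀ y → d * v + d * v ≤ ∣ ⟦ notForcing? 𝓕 y ⟧ ∣) →
    card 𝓕 + n ^ (1 + e) ≤ (n ∸ 1) C d
  spread v q v≥1 room N≤ v-large R-large with ManyUnreached.many-unreached 𝓕 v room v≥1 R-large
  ... | Ds , !Ds , Ds-unreached , Ds-many = +-cancelʳ-≤ N _ _ (begin
    (card 𝓕 + N) + N
      ≤⟨ +-monoˡ-≤ N (+-monoˡ-≤ N (≤-trans (length≤filter+filter¬ meetsForced? (unique 𝓕)) (+-monoʳ-≤ #forced (members-unforced 𝓕 avoids)))) ⟩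
    ((#forced + n * (k * (k * n ^ e))) + N) + N
      ≡⟨ regroup-spread #forced n k (n ^ e) ⟩
    #forced + (k * k + 2) * N
      ≤⟨ +-monoʳ-≤ #forced ∣Ds∣≥ ⟩
    #forced + length Ds
      ≤⟨ members-forced 𝓕 Ds !Ds Ds-unreached ⟩
    n C d
      ≤⟨ nCd≤ n ⟩
    (n ∸ 1) C d + N ∎)
    where
    open ≤-Reasoning
    N = n ^ (1 + e)
    k = 3 + e
    #forced = length (filter meetsForced? (members 𝓕))
    -- By Pascal's rule the difference is `(n ∸ 1) C (d ∸ 1)` for positive `n`; for `n = 0` the left
    -- side vanishes.
    nCd≤ : ∀ n → n C d ≤ (n ∸ 1) C d + n ^ (1 + e)
    nCd≤ zero    = z≤n
    nCd≤ (suc m) = begin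
      suc m C d                       ≡⟨ nCk+nC[k+1]≡[n+1]C[k+1] m (1 + e) ⟨
      m C (1 + e) + m C d             ≡⟨ +-comm (m C (1 + e)) (m C d) ⟩
      m C d + m C (1 + e)             ≤⟨ +-monoʳ-≤ (m C d) (≤-trans (mCk≤m^k m (1 + e)) (^-monoˡ-≤ (1 + e) (n≤1+n m))) ⟩
      m C d + suc m ^ (1 + e)         ∎
    -- In `v ^ d`, one factor `v` absorbs all constants by `v-large`, and the rest, `v ^ (1 + e)`,
    -- is compared with `N`.
    ∣Ds∣≥ : (k * k + 2) * N ≤ length Ds
    ∣Ds∣≥ = *-cancelʳ-≤ _ _ (d * d) (begin
      (k * k + 2) * N * (d * d)
        ≤⟨ *-monoˡ-≤ (d * d) (*-monoʳ-≤ (k * k + 2) N≤) ⟩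
      (k * k + 2) * (q * v ^ (1 + e)) * (d * d)
        ≡⟨ rotate-factors (k * k + 2) q (v ^ (1 + e)) (d * d) ⟩
      (d * d) * ((k * k + 2) * q) * v ^ (1 + e)
        ≤⟨ *-monoˡ-≤ (v ^ (1 + e)) v-large ⟩
      v ^ d
        ≤⟨ Ds-many ⟩
      length Ds * (d * d) ∎)

-- For scale · v ≤ n, the bound R < 2dv is small enough for the concentrated case; loss is the q in
-- n^(d-1) ≤ q v^(d-1); from v = threshold on, the missed d-sets outnumber the O(n^(d-1)) error terms.
scale : ℕ → ℕ
scale e = (1 + (1 + e) * (4 + e)) * ((2 + e) + (2 + e))

loss : ℕ → ℕ
loss e = (scale e + scale e) ^ (1 + e)

threshold : ℕ → ℕ
threshold e = (2 + e) * (2 + e) * (((3 + e) * (3 + e) + 2) * loss e)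

-- The cases are whether or not some `y` leaves fewer than `2 * d * v` points not forcing it. A
-- deficit arises as a power of `u` in one case and of `n` in the other; `s` and `loss e` give both
-- a common form.
star-or-deficit : ∀ {n e} (𝓕 : UniformFamily n (3 + e)) → AvoidsTrace 1 𝓕 →
  ∀ v → 1 ≤ v → threshold e ≤ v → scale e * v ≤ n → n ≤ (scale e + scale e) * v →
  (IsStar 𝓕 × card 𝓕 ≤ (n ∸ 1) C (2 + e)) ⊎
  ∃[ s ] (card 𝓕 + s ≤ (n ∸ 1) C (2 + e) × n ^ (1 + e) ≤ loss e * s)
star-or-deficit {n} {e} 𝓕 avoids v v≥1 v-large n≥ n≤ with any? (λ y → ∣ ⟦ notForcing? 𝓕 y ⟧ ∣ <? d * v + d * v)
  where
  d : ℕ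
  d = 2 + e
... | no ¬concentrated = inj₂ (n ^ (1 + e) ,
  Deficit.spread 𝓕 avoids v (loss e) v≥1 room N≤ v-large (λ y → ≮⇒≥ λ R< → ¬concentrated (y , R<)) ,
  m≤n*m (n ^ (1 + e)) (loss e) {{m^n≢0 (scale e + scale e) (1 + e)}})
  where
  open ≤-Reasoning
  N≤ : n ^ (1 + e) ≤ loss e * v ^ (1 + e)
  N≤ = ≤-trans (^-monoˡ-≤ (1 + e) n≤) (≤-reflexive (^-distribʳ-* (1 + e) (scale e + scale e) v))
  room : (4 + e) * v ≤ n
  room = begin
    (4 + e) * v                    ≤⟨ *-monoˡ-≤ v (m≤m+n (4 + e) (e * (4 + e))) ⟩
    ((1 + e) * (4 + e)) * v        ≤⟨ *-monoˡ-≤ v (n≤1+n ((1 + e) * (4 + e))) ⟩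
    (1 + (1 + e) * (4 + e)) * v    ≤⟨ *-monoˡ-≤ v (m≤m*n (1 + (1 + e) * (4 + e)) ((2 + e) + (2 + e))) ⟩
    scale e * v                    ≤⟨ n≥ ⟩
    n                              ∎
... | yes (y , R<) = Sum.map₂ (λ deficit → u ^ (1 + e) , deficit , N≤) (Deficit.concentrated 𝓕 avoids y u R< room)
  where
  open ≤-Reasoning
  u : ℕ
  u = (2 + e) * v + (2 + e) * v
  room : (1 + (1 + e) * (4 + e)) * u ≤ n
  room = begin
    (1 + (1 + e) * (4 + e)) * u                            ≡⟨ cong ((1 + (1 + e) * (4 + e)) *_) (*-distribʳ-+ v (2 + e) (2 + e)) ⟨
    (1 + (1 + e) * (4 + e)) * (((2 + e) + (2 + e)) * v)    ≡⟨ *-assoc (1 + (1 + e) * (4 + e)) ((2 + e) + (2 + e)) v ⟨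
    scale e * v                                            ≤⟨ n≥ ⟩
    n                                                      ∎
  v≤u : v ≤ u
  v≤u = ≤-trans (m≤m+n v ((1 + e) * v)) (m≤m+n ((2 + e) * v) ((2 + e) * v))
  N≤ : n ^ (1 + e) ≤ loss e * u ^ (1 + e)
  N≤ = begin
    n ^ (1 + e)                            ≤⟨ ^-monoˡ-≤ (1 + e) (≤-trans n≤ (*-monoʳ-≤ (scale e + scale e) v≤u)) ⟩
    ((scale e + scale e) * u) ^ (1 + e)    ≡⟨ ^-distribʳ-* (1 + e) (scale e + scale e) u ⟩
    loss e * u ^ (1 + e)                   ∎

-- Passage to rational numbers and choice of constants

-- The inequality N + a (1 + q) ≤ b (1 + q), in the shape to which a ≤ b - N / (1 + q) unfolds in ℚᵘ.
clear-denominators : ∀ a b N q → N + a * suc q ≤ b * suc q →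
  ℤ.+ a ℤ.* ℤ.+ suc (q * 1 + 0) ℤ.≤ (ℤ.+ b ℤ.* ℤ.+ suc (q * 1) ℤ.+ (ℤ.- (ℤ.+ 1 ℤ.* ℤ.+ N)) ℤ.* ℤ.+ 1) ℤ.* ℤ.+ 1
clear-denominators a b N q N+a[1+q]≤b[1+q] = begin
  ℤ.+ a ℤ.* ℤ.+ suc (q * 1 + 0)
    ≡⟨ cong (λ m → ℤ.+ a ℤ.* ℤ.+ suc m) (trans (+-identityʳ (q * 1)) (*-identityʳ q)) ⟩
  ℤ.+ a ℤ.* ℤ.+ suc q
    ≡⟨ ℤ.pos-* a (suc q) ⟨
  ℤ.+ (a * suc q)
    ≤⟨ numerator-nonneg ⟩
  ℤ.+ (b * suc q) ℤ.- ℤ.+ N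
    ≡⟨ cong₂ ℤ._+_ (trans (ℤ.pos-* b (suc q)) (cong (λ m → ℤ.+ b ℤ.* ℤ.+ suc m) (sym (*-identityʳ q))))
         (sym (trans (ℤ.*-identityʳ (ℤ.- (ℤ.+ 1 ℤ.* ℤ.+ N))) (cong ℤ.-_ (ℤ.*-identityˡ (ℤ.+ N))))) ⟩
  ℤ.+ b ℤ.* ℤ.+ suc (q * 1) ℤ.+ (ℤ.- (ℤ.+ 1 ℤ.* ℤ.+ N)) ℤ.* ℤ.+ 1
    ≡⟨ ℤ.*-identityʳ (ℤ.+ b ℤ.* ℤ.+ suc (q * 1) ℤ.+ (ℤ.- (ℤ.+ 1 ℤ.* ℤ.+ N)) ℤ.* ℤ.+ 1) ⟨
  (ℤ.+ b ℤ.* ℤ.+ suc (q * 1) ℤ.+ (ℤ.- (ℤ.+ 1 ℤ.* ℤ.+ N)) ℤ.* ℤ.+ 1) ℤ.* ℤ.+ 1 ∎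
  where
  open ℤ.≤-Reasoning
  numerator-nonneg : ℤ.+ (a * suc q) ℤ.≤ ℤ.+ (b * suc q) ℤ.- ℤ.+ N
  numerator-nonneg = begin
    ℤ.+ (a * suc q)                  ≤⟨ ℤ.+≤+ (m+n≤o⇒m≤o∸n (a * suc q) (≤-trans (≤-reflexive (+-comm (a * suc q) N)) N+a[1+q]≤b[1+q])) ⟩
    ℤ.+ (b * suc q ∸ N)              ≡⟨ ℤ.⊖-≥ (m+n≤o⇒m≤o N N+a[1+q]≤b[1+q]) ⟨
    b * suc q ℤ.⊖ N                  ≡⟨ ℤ.m-n≡m⊖n (b * suc q) N ⟨
    ℤ.+ (b * suc q) ℤ.- ℤ.+ N        ∎

-- From `N ≤ q * s` follows `N / (1 + q) ≤ s`, and the successor keeps the denominator nonzero for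
-- every `q`. The comparison is made in `ℚᵘ`, where fractions are not reduced and it becomes an
-- inequality of integers.
rational-deficit : ∀ {a b s N} q → a + s ≤ b → N ≤ q * s →
  fromℕ a ≤ℚ fromℕ b -ℚ (ℤ.+ 1 ℚ./ suc q) *ℚ fromℕ N
rational-deficit {a} {b} {s} {N} q a+s≤b N≤qs = ℚ.toℚᵘ-cancel-≤ (begin
  ℚ.toℚᵘ (fromℕ a)
    ≃⟨ ℚ.toℚᵘ-fromℚᵘ (ℚᵘ.mkℚᵘ (ℤ.+ a) 0) ⟩
  ℚᵘ.mkℚᵘ (ℤ.+ a) 0
    ≤⟨ ℚᵘ.*≤* (clear-denominators a b N q N+a[1+q]≤b[1+q]) ⟩
  ℚᵘ.mkℚᵘ (ℤ.+ b) 0 ℚᵘ.- ℚᵘ.mkℚᵘ (ℤ.+ 1) q ℚᵘ.* ℚᵘ.mkℚᵘ (ℤ.+ N) 0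
    ≃⟨ ℚᵘ.+-cong (ℚᵘ.≃-sym (ℚ.toℚᵘ-fromℚᵘ (ℚᵘ.mkℚᵘ (ℤ.+ b) 0))) (ℚᵘ.-‿cong (ℚᵘ.*-cong
         (ℚᵘ.≃-sym (ℚ.toℚᵘ-fromℚᵘ (ℚᵘ.mkℚᵘ (ℤ.+ 1) q))) (ℚᵘ.≃-sym (ℚ.toℚᵘ-fromℚᵘ (ℚᵘ.mkℚᵘ (ℤ.+ N) 0))))) ⟩
  ℚ.toℚᵘ (fromℕ b) ℚᵘ.- ℚ.toℚᵘ c ℚᵘ.* ℚ.toℚᵘ (fromℕ N)
    ≃⟨ ℚᵘ.+-congʳ (ℚ.toℚᵘ (fromℕ b)) (ℚᵘ.-‿cong (ℚ.toℚᵘ-homo-* c (fromℕ N))) ⟨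
  ℚ.toℚᵘ (fromℕ b) ℚᵘ.- ℚ.toℚᵘ (c *ℚ fromℕ N)
    ≃⟨ ℚᵘ.+-congʳ (ℚ.toℚᵘ (fromℕ b)) (ℚ.toℚᵘ-homo‿- (c *ℚ fromℕ N)) ⟨
  ℚ.toℚᵘ (fromℕ b) ℚᵘ.+ ℚ.toℚᵘ (ℚ.- (c *ℚ fromℕ N))
    ≃⟨ ℚ.toℚᵘ-homo-+ (fromℕ b) (ℚ.- (c *ℚ fromℕ N)) ⟨
  ℚ.toℚᵘ (fromℕ b -ℚ c *ℚ fromℕ N) ∎)
  where
  open ℚᵘ.≤-Reasoning
  c : ℚ
  c = ℤ.+ 1 ℚ./ suc q
  N+a[1+q]≤b[1+q] : N + a * suc q ≤ b * suc q
  N+a[1+q]≤b[1+q] = ≤-trans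
    (+-monoˡ-≤ (a * suc q) (≤-trans N≤qs (≤-trans (*-monoˡ-≤ s (n≤1+n q)) (≤-reflexive (*-comm (suc q) s)))))
    (≤-trans (≤-reflexive (trans (+-comm (s * suc q) (a * suc q)) (sym (*-distribʳ-+ (suc q) a s)))) (*-monoˡ-≤ (suc q) a+s≤b))

0<1/[1+q] : ∀ q → 0ℚ <ℚ ℤ.+ 1 ℚ./ suc q
0<1/[1+q] q = ℚ.positive⁻¹ (ℤ.+ 1 ℚ./ suc q) {{ℚ.normalize-pos 1 (suc q)}}

-- The quotient will serve as `v`. It is positive, so the remainder, being less than `m`, is at most
-- `m * (n / m)`; hence the factor `m + m`.
quotient-bounds : ∀ m t n .{{_ : NonZero m}} → suc t * m ≤ n →
  suc t ≤ n / m × m * (n / m) ≤ n × n ≤ (m + m) * (n / m)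
quotient-bounds m t n n≥ = large , ≤-trans (≤-reflexive (*-comm m (n / m))) (m/n*n≤m n m) , (begin
  n                          ≡⟨ m≡m%n+[m/n]*n n m ⟩
  n % m + n / m * m          ≤⟨ +-mono-≤ (<⇒≤ (m%n<n n m)) (≤-reflexive (*-comm (n / m) m)) ⟩
  m + m * (n / m)            ≤⟨ +-monoˡ-≤ (m * (n / m)) (m≤m*n m (n / m) {{>-nonZero (≤-trans (s≤s z≤n) large)}}) ⟩
  m * (n / m) + m * (n / m)  ≡⟨ *-distribʳ-+ (n / m) m m ⟨
  (m + m) * (n / m)          ∎)
  where
  open ≤-Reasoning
  large : suc t ≤ n / m
  large = begin
    suc t              ≡⟨ m*n/n≡m (suc t) m ⟨
    suc t * m / m      ≤⟨ /-monoˡ-≤ m n≥ ⟩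
    n / m              ∎

theorem5p2 : (d : ℕ) → d ≥ 2 →
    ∃[ n₀ ] ∃[ c ] (0ℚ <ℚ c ×
    ((n : ℕ) → n ≥ n₀ → (𝓕 : UniformFamily n (suc d)) → AvoidsTrace 1 𝓕 →
    ((IsStar 𝓕 × card 𝓕 ≤ (n ∸ 1) C d)
    ⊎ (fromℕ (card 𝓕) ≤ℚ fromℕ ((n ∸ 1) C d) -ℚ c *ℚ fromℕ (n ^ (d ∸ 1))))
    × card 𝓕 ≤ (n ∸ 1) C d))
theorem5p2 (suc (suc e)) (s≤s (s≤s z≤n)) = suc (threshold e) * scale e , c , 0<1/[1+q] (loss e) , bound
  where
  c : ℚ
  c = ℤ.+ 1 ℚ./ suc (loss e)
  bound : (n : ℕ) → n ≥ suc (threshold e) * scale e → (𝓕 : UniformFamily n (3 + e)) → AvoidsTrace 1 𝓕 →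
    ((IsStar 𝓕 × card 𝓕 ≤ (n ∸ 1) C (2 + e))
    ⊎ (fromℕ (card 𝓕) ≤ℚ fromℕ ((n ∸ 1) C (2 + e)) -ℚ c *ℚ fromℕ (n ^ (1 + e))))
    × card 𝓕 ≤ (n ∸ 1) C (2 + e)
  -- With `v = n / scale e`, the choice of `n₀` gives `v ≥ 1 + threshold e`, which yields both
  -- `1 ≤ v` and `threshold e ≤ v`.
  bound n n≥n₀ 𝓕 avoids = let v≥ , n≥ , n≤ = quotient-bounds (scale e) (threshold e) n n≥n₀ in
    [ (λ star → inj₁ star , proj₂ star)
    , (λ { (s , deficit , N≤) → inj₂ (rational-deficit (loss e) deficit N≤) , ≤-trans (m≤m+n (card 𝓕) s) deficit })
    ]′ (star-or-deficit 𝓕 avoids (n / scale e) (≤-trans (s≤s z≤n) v≥) (≤-trans (n≤1+n (threshold e)) v≥) n≥ n≤)
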